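{- Let $\mathbf{T}_0$ be the tense algebra whose Boolean reduct is the two-element Boolean algebra and whose operators $f$ and $g$ are both the identity map, and let $\operatorname{Var}(\mathbf{T}_0)$ be the variety it generates. Then $\operatorname{Var}(\mathbf{T}_0)$ has $2^{\aleph_0}$ join-irreducible covers in $\boldsymbol{\Lambda}_{\mathrm{TTA}}$ and also in $\boldsymbol{\Lambda}_{\mathrm{TA}}$; that is, in each of these two lattices the set of join-irreducible covers of $\operatorname{Var}(\mathbf{T}_0)$ has cardinality $2^{\aleph_0}$.
   Context: A tense algebra is an algebra $\mathbf{A}=\langle A;\vee,\wedge,{}',f,g,0,1\rangle$ such that $\langle A;\vee,\wedge,{}',0,1\rangle$ is a Boolean algebra and $f,g$ are unary operations forming a conjugate pair: $f(x)\wedge y=0\iff x\wedge g(y)=0$ for all $x,y\in A$. A tense algebra is total if $f(x)\vee g(x)=1$ for all $x\in A$ with $x\neq 0$. The class of all tense algebras is a variety. $\boldsymbol{\Lambda}_{\mathrm{TA}}$ denotes the lattice of subvarieties of the variety of all tense algebras; $\boldsymbol{\Lambda}_{\mathrm{TTA}}$ denotes the lattice of subvarieties of the variety generated by the class of all total tense algebras. In a lattice, $b$ covers $a$ if $a<b$ and there is no $c$ with $a<c<b$; a non-bottom element $b$ is join-irreducible if $b=c\vee d$ implies $b=c$ or $b=d$. -}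

module Defs where

open import Level using (_⊔_; Lift; 0ℓ) renaming (suc to lsuc)
open import Algebra.Core using (Op₁; Op₂)
open import Algebra.Definitions using (Congruent₁; Congruent₂)
open import Algebra.Lattice.Bundles using (BooleanAlgebra)
open import Algebra.Lattice.Structures using (IsBooleanAlgebra)
import Algebra.Lattice.Properties.BooleanAlgebra as BAProperties
open import Data.Bool.Base as Bool using (Bool; true; false; not)
import Data.Bool.Properties as Boolₚ
open import Data.Nat.Base using (ℕ)
open import Data.Product.Base using (Σ; _×_; _,_; proj₁; proj₂; ∃)
open import Data.Sum.Base using (_⊎_; inj₁; inj₂)
open import Function.Base using (id; _∘_)
open import Function.Bundles using (Bijection; _⇔_; mk⇔; Equivalence)
open import Relation.Binary.Bundles using (Setoid)
open import Relation.Binary.Core using (Rel)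
open import Relation.Binary.Structures using (IsEquivalence)
open import Relation.Binary.Lattice using (BoundedLattice)
open import Relation.Binary.PropositionalEquality as ≡ using (_≡_; _→-setoid_)
import Relation.Binary.Construct.NonStrictToStrict as Strict
import Relation.Binary.Reasoning.Setoid as SetoidReasoning
open import Relation.Nullary.Negation using (¬_; contradiction)
open import Relation.Unary using (Pred; _∈_; _⊆_; _≐_; _∩_; _∪_)

record Algebra : Set₁ where
  infix  4 _≈_
  infixr 6 _∨_
  infixr 7 _∧_
  infix  8 _′
  field
    Carrier       : Set
    _≈_           : Rel Carrier 0ℓ
    isEquivalence : IsEquivalence _≈_
    _∨_ _∧_       : Op₂ Carrier
    _′ f g        : Op₁ Carrier
    0# 1#         : Carrier
    ∨-cong        : Congruent₂ _≈_ _∨_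
    ∧-cong        : Congruent₂ _≈_ _∧_
    ′-cong        : Congruent₁ _≈_ _′
    f-cong        : Congruent₁ _≈_ f
    g-cong        : Congruent₁ _≈_ g

  open IsEquivalence isEquivalence public using (refl; sym; trans)

  setoid : Setoid 0ℓ 0ℓ
  setoid = record { isEquivalence = isEquivalence }

Class : Set₂
Class = Pred Algebra (lsuc 0ℓ)

module Terms where
  infixr 6 _∨_
  infixr 7 _∧_
  infix  8 _′

  data Term : Set where
    var     : ℕ → Term
    _∨_ _∧_ : Term → Term → Term
    _′ f g  : Term → Term
    0# 1#   : Term

open Terms public using (Term)

Equation : Set
Equation = Term × Term

module _ (A : Algebra) where
  private module A = Algebra A
  open Terms

  ⟦_⟧ : Term → (ℕ → A.Carrier) → A.Carrier
  ⟦ var i ⟧ ρ = ρ i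
  ⟦ s ∨ t ⟧ ρ = ⟦ s ⟧ ρ A.∨ ⟦ t ⟧ ρ
  ⟦ s ∧ t ⟧ ρ = ⟦ s ⟧ ρ A.∧ ⟦ t ⟧ ρ
  ⟦ t ′ ⟧   ρ = (⟦ t ⟧ ρ) A.′
  ⟦ f t ⟧   ρ = A.f (⟦ t ⟧ ρ)
  ⟦ g t ⟧   ρ = A.g (⟦ t ⟧ ρ)
  ⟦ 0# ⟧    ρ = A.0#
  ⟦ 1# ⟧    ρ = A.1#

infix 4 _⊨_

_⊨_ : Algebra → Equation → Set
A ⊨ (s , t) = ∀ ρ → ⟦ A ⟧ s ρ ≈ ⟦ A ⟧ t ρ
  where open Algebra A using (_≈_)

Mod : Pred Equation (lsuc 0ℓ) → Class
Mod E A = ∀ e → e ∈ E → A ⊨ e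

Id : Class → Pred Equation (lsuc 0ℓ)
Id K e = ∀ A → A ∈ K → A ⊨ e

-- Classes consist of algebras whose carrier and equality are small; axioms may
-- be Set₁-valued so that the theory of an arbitrary class is allowed.
record Variety : Set₂ where
  field
    class       : Class
    axioms      : Pred Equation (lsuc 0ℓ)
    axiomatised : class ≐ Mod axioms

open Variety public using (class)

-- The variety generated by K: the least one containing it, by Var-upper and
-- Var-least.
Var : Class → Variety
Var K = record { class = Mod (Id K) ; axioms = Id K ; axiomatised = id , id }

Var-upper : ∀ K → K ⊆ class (Var K)
Var-upper K A∈K e e∈Id = e∈Id _ A∈K

Var-least : ∀ K (V : Variety) → K ⊆ class V → class (Var K) ⊆ class V
Var-least K V K⊆V A∈Var = proj₂ axiomatised λ e e∈E →
  A∈Var e λ B B∈K → proj₁ axiomatised (K⊆V B∈K) e e∈E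
  where open Variety V using (axiomatised)

Subvariety : Variety → Set₂
Subvariety V = Σ Variety λ W → class W ⊆ class V

Trivial : Variety
Trivial = Var λ A → Lift (lsuc 0ℓ) (let open Algebra A in ∀ x y → x ≈ y)

Trivial-least : ∀ (V : Variety) → class Trivial ⊆ class V
Trivial-least V = Var-least _ V λ (Level.lift A-trivial) →
  proj₂ (Variety.axiomatised V) λ _ _ _ → A-trivial _ _

_⊓_ : Variety → Variety → Variety
V ⊓ W = record
  { class       = class V ∩ class W
  ; axioms      = V.axioms ∪ W.axioms
  ; axiomatised =
      (λ { (A∈V , A∈W) e (inj₁ e∈) → proj₁ V.axiomatised A∈V e e∈
         ; (A∈V , A∈W) e (inj₂ e∈) → proj₁ W.axiomatised A∈W e e∈ })
    , (λ A⊨ → proj₂ V.axiomatised (λ e → A⊨ e ∘ inj₁)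
            , proj₂ W.axiomatised (λ e → A⊨ e ∘ inj₂))
  }
  where
  module V = Variety V
  module W = Variety W

_⊔ᵛ_ : Variety → Variety → Variety
V ⊔ᵛ W = Var (class V ∪ class W)

-- Subvarieties count as equal when they have the same members.
Λ : Variety → BoundedLattice (lsuc (lsuc 0ℓ)) (lsuc 0ℓ) (lsuc 0ℓ)
Λ V = record
  { Carrier = Subvariety V
  ; _≈_     = λ (X , _) (Y , _) → class X ≐ class Y
  ; _≤_     = λ (X , _) (Y , _) → class X ⊆ class Y
  ; _∨_     = λ (X , X⊆V) (Y , Y⊆V) →
                X ⊔ᵛ Y , Var-least (class X ∪ class Y) V
                           λ { (inj₁ A∈X) → X⊆V A∈X ; (inj₂ A∈Y) → Y⊆V A∈Y }
  ; _∧_     = λ (X , X⊆V) (Y , _) → X ⊓ Y , X⊆V ∘ proj₁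
  ; ⊤       = V , id
  ; ⊥       = Trivial , Trivial-least V
  ; isBoundedLattice = record
    { isLattice = record
      { isPartialOrder = record
        { isPreorder = record
          { isEquivalence = record
            { refl  = id , id
            ; sym   = λ (p , q) → q , p
            ; trans = λ (p , q) (r , s) → r ∘ p , q ∘ s
            }
          ; reflexive = proj₁
          ; trans     = λ p q → q ∘ p
          }
        ; antisym = _,_
        }
      ; supremum = λ (X , _) (Y , _) →
            Var-upper (class X ∪ class Y) ∘ inj₁
          , Var-upper (class X ∪ class Y) ∘ inj₂
          , λ (Z , _) X⊆Z Y⊆Z → Var-least (class X ∪ class Y) Z
              λ { (inj₁ A∈X) → X⊆Z A∈X ; (inj₂ A∈Y) → Y⊆Z A∈Y }
      ; infimum = λ _ _ → proj₁ , proj₂ , λ _ Z⊆X Z⊆Y A∈Z → Z⊆X A∈Z , Z⊆Y A∈Z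
      }
    ; maximum = proj₂
    ; minimum = λ (X , _) → Trivial-least X
    }
  }

module _ {c ℓ₁ ℓ₂} (L : BoundedLattice c ℓ₁ ℓ₂) where
  open BoundedLattice L
  open Strict _≈_ _≤_ using (_<_)

  Covers : Carrier → Carrier → Set (c ⊔ ℓ₁ ⊔ ℓ₂)
  Covers b a = a < b × ¬ ∃ λ x → a < x × x < b

  JoinIrreducible : Carrier → Set (c ⊔ ℓ₁)
  JoinIrreducible b = ¬ b ≈ ⊥ × (∀ x y → b ≈ x ∨ y → b ≈ x ⊎ b ≈ y)

  JoinIrreducibleCovers : Carrier → Setoid (c ⊔ ℓ₁ ⊔ ℓ₂) ℓ₁
  JoinIrreducibleCovers a = record
    { Carrier       = ∃ λ b → Covers b a × JoinIrreducible b
    ; _≈_           = λ b c → proj₁ b ≈ proj₁ c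
    ; isEquivalence = record { refl = Eq.refl ; sym = Eq.sym ; trans = Eq.trans }
    }

record IsTenseAlgebra (A : Algebra) : Set where
  open Algebra A
  field
    isBooleanAlgebra : IsBooleanAlgebra _≈_ _∨_ _∧_ _′ 1# 0#
    conjugate        : ∀ x y → (f x ∧ y ≈ 0#) ⇔ (x ∧ g y ≈ 0#)

IsTotal : Pred Algebra 0ℓ
IsTotal A = ∀ x → ¬ x ≈ 0# → f x ∨ g x ≈ 1#
  where open Algebra A

module _ where
  open Terms

  -- The last four equations say that f and g are monotone,
  -- x ∧ g ((f x)′) ≈ 0 and f ((g x)′) ∧ x ≈ 0; over Boolean algebras this is
  -- equivalent to conjugacy.
  data TenseAxiom : Pred Equation (lsuc 0ℓ) where
    ∨-comm        : TenseAxiom (var 0 ∨ var 1 , var 1 ∨ var 0)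
    ∨-assoc       : TenseAxiom ((var 0 ∨ var 1) ∨ var 2 , var 0 ∨ (var 1 ∨ var 2))
    ∧-comm        : TenseAxiom (var 0 ∧ var 1 , var 1 ∧ var 0)
    ∧-assoc       : TenseAxiom ((var 0 ∧ var 1) ∧ var 2 , var 0 ∧ (var 1 ∧ var 2))
    ∨-absorbs-∧   : TenseAxiom (var 0 ∨ (var 0 ∧ var 1) , var 0)
    ∧-absorbs-∨   : TenseAxiom (var 0 ∧ (var 0 ∨ var 1) , var 0)
    ∨-distribˡ-∧  : TenseAxiom (var 0 ∨ (var 1 ∧ var 2) , (var 0 ∨ var 1) ∧ (var 0 ∨ var 2))
    ∨-distribʳ-∧  : TenseAxiom ((var 1 ∧ var 2) ∨ var 0 , (var 1 ∨ var 0) ∧ (var 2 ∨ var 0))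
    ∧-distribˡ-∨  : TenseAxiom (var 0 ∧ (var 1 ∨ var 2) , (var 0 ∧ var 1) ∨ (var 0 ∧ var 2))
    ∧-distribʳ-∨  : TenseAxiom ((var 1 ∨ var 2) ∧ var 0 , (var 1 ∧ var 0) ∨ (var 2 ∧ var 0))
    ∨-complementˡ : TenseAxiom (var 0 ′ ∨ var 0 , 1#)
    ∨-complementʳ : TenseAxiom (var 0 ∨ var 0 ′ , 1#)
    ∧-complementˡ : TenseAxiom (var 0 ′ ∧ var 0 , 0#)
    ∧-complementʳ : TenseAxiom (var 0 ∧ var 0 ′ , 0#)
    f-mono        : TenseAxiom (f (var 0) ∧ f (var 0 ∨ var 1) , f (var 0))
    g-mono        : TenseAxiom (g (var 0) ∧ g (var 0 ∨ var 1) , g (var 0))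
    g-conj        : TenseAxiom (var 0 ∧ g (f (var 0) ′) , 0#)
    f-conj        : TenseAxiom (f (g (var 0) ′) ∧ var 0 , 0#)

private
  module _ {A : Algebra} where
    open Algebra A

    module Boolean (isBA : IsBooleanAlgebra _≈_ _∨_ _∧_ _′ 1# 0#) where
      booleanAlgebra : BooleanAlgebra 0ℓ 0ℓ
      booleanAlgebra = record { isBooleanAlgebra = isBA }

      open BooleanAlgebra booleanAlgebra public
        using (∧-congˡ; ∧-congʳ; ∨-congˡ; ∨-congʳ)
      module B = BooleanAlgebra booleanAlgebra
      open BAProperties booleanAlgebra public
      open SetoidReasoning setoid public

      disjoint⇒≤′ : ∀ {x y} → x ∧ y ≈ 0# → x ∧ y ′ ≈ x
      disjoint⇒≤′ {x} {y} xy≈0 = begin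
        x ∧ y ′            ≈⟨ ∨-identityˡ _ ⟨
        0# ∨ x ∧ y ′       ≈⟨ ∨-congʳ xy≈0 ⟨
        x ∧ y ∨ x ∧ y ′    ≈⟨ B.∧-distribˡ-∨ x y (y ′) ⟨
        x ∧ (y ∨ y ′)      ≈⟨ ∧-congˡ (B.∨-complementʳ y) ⟩
        x ∧ 1#             ≈⟨ ∧-identityʳ x ⟩
        x                  ∎

      disjoint′⇒≤ : ∀ {x y} → x ∧ y ′ ≈ 0# → x ∧ y ≈ x
      disjoint′⇒≤ {x} {y} p = trans (∧-congˡ (sym (¬-involutive y))) (disjoint⇒≤′ p)

      ≤⇒∨ : ∀ {x y} → x ∧ y ≈ x → x ∨ y ≈ y
      ≤⇒∨ {x} {y} x≤y = begin
        x ∨ y      ≈⟨ ∨-congʳ x≤y ⟨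
        x ∧ y ∨ y  ≈⟨ B.∨-comm _ _ ⟩
        y ∨ x ∧ y  ≈⟨ ∨-congˡ (B.∧-comm x y) ⟩
        y ∨ y ∧ x  ≈⟨ B.∨-absorbs-∧ y x ⟩
        y          ∎

      shrinkˡ : ∀ {x y z} → x ∧ y ≈ x → y ∧ z ≈ 0# → x ∧ z ≈ 0#
      shrinkˡ {x} {y} {z} x≤y yz≈0 = begin
        x ∧ z        ≈⟨ ∧-congʳ x≤y ⟨
        (x ∧ y) ∧ z  ≈⟨ B.∧-assoc x y z ⟩
        x ∧ (y ∧ z)  ≈⟨ ∧-congˡ yz≈0 ⟩
        x ∧ 0#       ≈⟨ ∧-zeroʳ x ⟩
        0#           ∎

      shrinkʳ : ∀ {x y z} → x ∧ y ≈ x → z ∧ y ≈ 0# → z ∧ x ≈ 0#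
      shrinkʳ x≤y zy≈0 =
        trans (B.∧-comm _ _) (shrinkˡ x≤y (trans (B.∧-comm _ _) zy≈0))

    tense⇒axioms : IsTenseAlgebra A → A ∈ Mod TenseAxiom
    tense⇒axioms tense = holds
      where
      open IsTenseAlgebra tense
      open Boolean isBooleanAlgebra
      open Equivalence

      holds : A ∈ Mod TenseAxiom
      holds _ ∨-comm        ρ = B.∨-comm _ _
      holds _ ∨-assoc       ρ = B.∨-assoc _ _ _
      holds _ ∧-comm        ρ = B.∧-comm _ _
      holds _ ∧-assoc       ρ = B.∧-assoc _ _ _
      holds _ ∨-absorbs-∧   ρ = B.∨-absorbs-∧ _ _
      holds _ ∧-absorbs-∨   ρ = B.∧-absorbs-∨ _ _
      holds _ ∨-distribˡ-∧  ρ = B.∨-distribˡ-∧ _ _ _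
      holds _ ∨-distribʳ-∧  ρ = B.∨-distribʳ-∧ _ _ _
      holds _ ∧-distribˡ-∨  ρ = B.∧-distribˡ-∨ _ _ _
      holds _ ∧-distribʳ-∨  ρ = B.∧-distribʳ-∨ _ _ _
      holds _ ∨-complementˡ ρ = B.∨-complementˡ _
      holds _ ∨-complementʳ ρ = B.∨-complementʳ _
      holds _ ∧-complementˡ ρ = B.∧-complementˡ _
      holds _ ∧-complementʳ ρ = B.∧-complementʳ _
      holds _ f-mono        ρ = disjoint′⇒≤ (from (conjugate _ _)
                            (shrinkˡ (B.∧-absorbs-∨ _ _)
                              (to (conjugate _ _) (B.∧-complementʳ _))))
      holds _ g-mono        ρ = disjoint′⇒≤ (trans (B.∧-comm _ _) (to (conjugate _ _)
                            (shrinkʳ (B.∧-absorbs-∨ _ _)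
                              (from (conjugate _ _) (B.∧-complementˡ _)))))
      holds _ g-conj        ρ = to (conjugate _ _) (B.∧-complementʳ _)
      holds _ f-conj        ρ = from (conjugate _ _) (B.∧-complementˡ _)

    axioms⇒tense : A ∈ Mod TenseAxiom → IsTenseAlgebra A
    axioms⇒tense A⊨ = record
      { isBooleanAlgebra = isBA
      ; conjugate = λ x y → mk⇔
          (λ fx∧y≈0 → shrinkʳ (g-monotone (disjoint⇒≤′ (trans (B.∧-comm _ _) fx∧y≈0)))
                              (A⊨ _ g-conj (ρ x x x)))
          (λ x∧gy≈0 → shrinkˡ (f-monotone (disjoint⇒≤′ x∧gy≈0))
                              (A⊨ _ f-conj (ρ y y y)))
      }
      where
      ρ : Carrier → Carrier → Carrier → ℕ → Carrier
      ρ x y z 0 = x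
      ρ x y z 1 = y
      ρ x y z _ = z

      isBA : IsBooleanAlgebra _≈_ _∨_ _∧_ _′ 1# 0#
      isBA = record
        { isDistributiveLattice = record
          { isLattice = record
            { isEquivalence = isEquivalence
            ; ∨-comm     = λ x y → A⊨ _ ∨-comm (ρ x y y)
            ; ∨-assoc    = λ x y z → A⊨ _ ∨-assoc (ρ x y z)
            ; ∨-cong     = ∨-cong
            ; ∧-comm     = λ x y → A⊨ _ ∧-comm (ρ x y y)
            ; ∧-assoc    = λ x y z → A⊨ _ ∧-assoc (ρ x y z)
            ; ∧-cong     = ∧-cong
            ; absorptive = (λ x y → A⊨ _ ∨-absorbs-∧ (ρ x y y))
                         , (λ x y → A⊨ _ ∧-absorbs-∨ (ρ x y y))
            }
          ; ∨-distrib-∧ = (λ x y z → A⊨ _ ∨-distribˡ-∧ (ρ x y z))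
                        , (λ x y z → A⊨ _ ∨-distribʳ-∧ (ρ x y z))
          ; ∧-distrib-∨ = (λ x y z → A⊨ _ ∧-distribˡ-∨ (ρ x y z))
                        , (λ x y z → A⊨ _ ∧-distribʳ-∨ (ρ x y z))
          }
        ; ∨-complement = (λ x → A⊨ _ ∨-complementˡ (ρ x x x))
                       , (λ x → A⊨ _ ∨-complementʳ (ρ x x x))
        ; ∧-complement = (λ x → A⊨ _ ∧-complementˡ (ρ x x x))
                       , (λ x → A⊨ _ ∧-complementʳ (ρ x x x))
        ; ¬-cong = ′-cong
        }

      open Boolean isBA

      f-monotone : ∀ {x y} → x ∧ y ≈ x → f x ∧ f y ≈ f x
      f-monotone {x} {y} x≤y =
        trans (∧-congˡ (f-cong (sym (≤⇒∨ x≤y)))) (A⊨ _ f-mono (ρ x y y))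

      g-monotone : ∀ {x y} → x ∧ y ≈ x → g x ∧ g y ≈ g x
      g-monotone {x} {y} x≤y =
        trans (∧-congˡ (g-cong (sym (≤⇒∨ x≤y)))) (A⊨ _ g-mono (ρ x y y))

TA : Variety
TA = record
  { class       = λ A → Lift (lsuc 0ℓ) (IsTenseAlgebra A)
  ; axioms      = TenseAxiom
  ; axiomatised = tense⇒axioms ∘ Level.lower , Level.lift ∘ axioms⇒tense
  }

TotalTenseAlgebras : Class
TotalTenseAlgebras A = Lift (lsuc 0ℓ) (IsTenseAlgebra A × IsTotal A)

TTA : Variety
TTA = Var TotalTenseAlgebras

ΛTA ΛTTA : BoundedLattice (lsuc (lsuc 0ℓ)) (lsuc 0ℓ) (lsuc 0ℓ)
ΛTA  = Λ TA
ΛTTA = Λ TTA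

T₀ : Algebra
T₀ = record
  { Carrier       = Bool
  ; _≈_           = _≡_
  ; isEquivalence = ≡.isEquivalence
  ; _∨_           = Bool._∨_
  ; _∧_           = Bool._∧_
  ; _′            = not
  ; f             = id
  ; g             = id
  ; 0#            = false
  ; 1#            = true
  ; ∨-cong        = ≡.cong₂ Bool._∨_
  ; ∧-cong        = ≡.cong₂ Bool._∧_
  ; ′-cong        = ≡.cong not
  ; f-cong        = id
  ; g-cong        = id
  }

T₀-isTense : IsTenseAlgebra T₀
T₀-isTense = record
  { isBooleanAlgebra = Boolₚ.∨-∧-isBooleanAlgebra
  ; conjugate        = λ _ _ → mk⇔ id id
  }

T₀-isTotal : IsTotal T₀
T₀-isTotal false x≢0 = contradiction ≡.refl x≢0
T₀-isTotal true  _   = ≡.refl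

VarT₀ : Variety
VarT₀ = Var (_≡ T₀)

VarT₀∈ΛTA : BoundedLattice.Carrier ΛTA
VarT₀∈ΛTA = VarT₀ , Var-least _ TA λ { ≡.refl → Level.lift T₀-isTense }

VarT₀∈ΛTTA : BoundedLattice.Carrier ΛTTA
VarT₀∈ΛTTA = VarT₀ , λ {A} → Var-least _ TTA
  (λ { ≡.refl → Var-upper TotalTenseAlgebras {T₀}
                  (Level.lift (T₀-isTense , T₀-isTotal)) }) {A}

-- Binary sequences are compared pointwise.
HasCardinality2^ℵ₀ : ∀ {c ℓ} → Setoid c ℓ → Set (c ⊔ ℓ)
HasCardinality2^ℵ₀ S = Bijection (ℕ →-setoid Bool) S

{-# OPTIONS --safe #-}

-- A cover of Var T₀ is obtained from any total tense algebra A in which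
-- x ≤ f x and x ≤ g x but f is not the identity: extend the equational theory
-- of A to a theory M that is maximal among those not containing f x ≈ x. A
-- subvariety X of Mod M either satisfies f x ≈ x, and then lies in Var T₀, or
-- by maximality equals Mod M. So Mod M covers Var T₀ and is join-irreducible.
--
-- To get 2^ℵ₀ different covers, the algebras A are built from sequences
-- w : ℕ → Bool such that each digit of w can be read off from every x ≠ 0, 1
-- by a term. Sequences that differ at n then satisfy contradictory equations
-- for the n-th digit, which force f x ≈ x in a common model.
--
-- Conversely a variety is determined by its equations, of which there are
-- countably many, and the two injections combine by Cantor–Bernstein.

module Submission where

open import Defs hiding
  ( ∨-comm; ∨-assoc; ∧-comm; ∧-assoc; ∨-absorbs-∧; ∧-absorbs-∨; ∨-distribˡ-∧; ∨-distribʳ-∧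
  ; ∧-distribˡ-∨; ∧-distribʳ-∨; ∨-complementˡ; ∨-complementʳ; ∧-complementˡ; ∧-complementʳ)
open import Axiom.ExcludedMiddle using (ExcludedMiddle)
open import Data.Product.Base using (_×_)
open import Level using (_⊔_; Lift; lift; lower; 0ℓ) renaming (suc to lsuc)
open import Algebra.Lattice.Bundles using (BooleanAlgebra)
import Algebra.Lattice.Properties.BooleanAlgebra as BooleanAlgebraProperties
open import Algebra.Lattice.Structures using (IsBooleanAlgebra)
open import Data.Bool.Base as Bool using (Bool; true; false; not; if_then_else_)
import Data.Bool.Properties as Boolₚ
open import Data.List.Base using (List; []; _∷_)
open import Data.Nat.Base as ℕ using (ℕ; zero; suc; _≤_; _<_; z≤n; s≤s; _≤′_; ≤′-step)
open import Data.Nat.Binary.Base using (ℕᵇ; zero; 2[1+_]; 1+[2_]; toℕ; fromℕ)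
open import Data.Nat.Binary.Properties using (fromℕ-toℕ)
import Data.Nat.Properties as ℕₚ
open import Data.Product.Base using (Σ; ∃; _,_; proj₁; proj₂)
open import Data.Sum.Base as Sum using (_⊎_; inj₁; inj₂)
open import Function.Base using (id; _∘_; flip)
open import Function.Bundles using (Bijection; Injection; module Equivalence; mk⇔)
open import Relation.Binary.Bundles using (Setoid)
open import Relation.Binary.PropositionalEquality as ≡ using (_≡_; _≗_; _→-setoid_)
import Relation.Binary.Reasoning.Setoid as SetoidReasoning
open import Relation.Nullary using (¬_; Dec; yes; no; contradiction; does)
open import Relation.Nullary.Decidable.Core using (decidable-stable)
open import Relation.Unary using (Pred; _∈_; _∉_; _⊆_; _∪_; ｛_｝; _≐_)

-- Cantor–Bernstein

module CantorBernstein (em : ∀ {ℓ} → ExcludedMiddle ℓ)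
  {a ℓ₁ b ℓ₂} {A : Setoid a ℓ₁} {B : Setoid b ℓ₂}
  (i : Injection A B) (j : Injection B A) where

  private
    module A = Setoid A
    module B = Setoid B
    module I = Injection i
    module J = Injection j

  -- Tracing such a point back through `j` and `i` in turn ends at a point of `A` outside the range
  -- of `j`. The bijection is `i` on these points and the inverse of `j` on all others.
  data Stopping (x : A.Carrier) : Set (a ⊔ b ⊔ ℓ₁) where
    stop : (∀ y → ¬ J.to y A.≈ x) → Stopping x
    back : ∀ {z} → Stopping z → x A.≈ J.to (I.to z) → Stopping x

  stopping-resp : ∀ {x y} → x A.≈ y → Stopping x → Stopping y
  stopping-resp x≈y (stop no-source) = stop λ t jt≈y → no-source t (A.trans jt≈y (A.sym x≈y))
  stopping-resp x≈y (back s x≈jiz)   = back s (A.trans (A.sym x≈y) x≈jiz)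

  preimage : ∀ {x} → ¬ Stopping x → ∃ λ y → J.to y A.≈ x
  preimage {x} ¬s = decidable-stable em λ none → ¬s (stop λ y jy≈x → none (y , jy≈x))

  -- The decision is a separate argument so that proofs can split on it; by `mapBy-cong` its choice
  -- does not matter.
  mapBy : ∀ x → Dec (Stopping x) → B.Carrier
  mapBy x (yes _) = I.to x
  mapBy x (no ¬s) = proj₁ (preimage ¬s)

  mapBy-cong : ∀ {x y} d e → x A.≈ y → mapBy x d B.≈ mapBy y e
  mapBy-cong (yes _) (yes _)  x≈y = I.cong x≈y
  mapBy-cong (yes s) (no ¬s)  x≈y = contradiction (stopping-resp x≈y s) ¬s
  mapBy-cong (no ¬s) (yes s)  x≈y = contradiction (stopping-resp (A.sym x≈y) s) ¬s
  mapBy-cong (no ¬s) (no ¬s′) x≈y = J.injective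
    (A.trans (proj₂ (preimage ¬s)) (A.trans x≈y (A.sym (proj₂ (preimage ¬s′)))))

  mapBy-injective : ∀ {x y} d e → mapBy x d B.≈ mapBy y e → x A.≈ y
  mapBy-injective (yes _) (yes _)  eq = I.injective eq
  -- The second point would be `j (i x)`, hence stopping like `x`.
  mapBy-injective (yes s) (no ¬s)  eq = contradiction
    (back s (A.trans (A.sym (proj₂ (preimage ¬s))) (J.cong (B.sym eq)))) ¬s
  mapBy-injective (no ¬s) (yes s)  eq = contradiction
    (back s (A.trans (A.sym (proj₂ (preimage ¬s))) (J.cong eq))) ¬s
  mapBy-injective (no ¬s) (no ¬s′) eq =
    A.trans (A.sym (proj₂ (preimage ¬s))) (A.trans (J.cong eq) (proj₂ (preimage ¬s′)))

  -- `J.to y` has a source, so if it is stopping it is `j (i z)` with `z` stopping, and `z` is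
  -- mapped to `y`. Otherwise `J.to y` is mapped to `y`.
  mapBy-surjective : ∀ y → ∃ λ x → ∀ d → mapBy x d B.≈ y
  mapBy-surjective y with em {P = Stopping (J.to y)}
  ... | yes (stop no-source) = contradiction A.refl (no-source y)
  ... | yes (back {z} s jy≈jiz) = z , λ
    { (yes _) → B.sym (J.injective jy≈jiz)
    ; (no ¬s) → contradiction s ¬s }
  ... | no ¬s = J.to y , λ
    { (yes s)  → contradiction s ¬s
    ; (no ¬s′) → J.injective (proj₂ (preimage ¬s′)) }

  bijection : Bijection A B
  bijection = record
    { to        = λ x → mapBy x em
    ; cong      = mapBy-cong em em
    ; bijective = mapBy-injective em em
                , λ y → let (x , hx≈y) = mapBy-surjective y in
                        x , λ z≈x → B.trans (mapBy-cong em em z≈x) (hx≈y em)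
    }

-- Enumeration of the equations

-- Terms are written in reverse Polish notation; the n-th instruction is n odd
-- digits followed by an even one.

instruction : ℕ → ℕᵇ → ℕᵇ
instruction zero    k = 2[1+ k ]
instruction (suc n) k = 1+[2 instruction n k ]

-- The second argument is the program that follows.
encode : Term → ℕᵇ → ℕᵇ
encode (s Terms.∨ t) k = encode s (encode t (instruction 0 k))
encode (s Terms.∧ t) k = encode s (encode t (instruction 1 k))
encode (t Terms.′)   k = encode t (instruction 2 k)
encode (Terms.f t)   k = encode t (instruction 3 k)
encode (Terms.g t)   k = encode t (instruction 4 k)
encode Terms.0#      k = instruction 5 k
encode Terms.1#      k = instruction 6 k
encode (Terms.var i) k = instruction (7 ℕ.+ i) k

-- An operation that lacks operands leaves the stack alone, so every number is a program.
execute : ℕ → List Term → List Term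
execute 0 (t ∷ s ∷ ts) = (s Terms.∨ t) ∷ ts
execute 1 (t ∷ s ∷ ts) = (s Terms.∧ t) ∷ ts
execute 2 (t ∷ ts)     = (t Terms.′) ∷ ts
execute 3 (t ∷ ts)     = Terms.f t ∷ ts
execute 4 (t ∷ ts)     = Terms.g t ∷ ts
execute 5 ts           = Terms.0# ∷ ts
execute 6 ts           = Terms.1# ∷ ts
execute (suc (suc (suc (suc (suc (suc (suc i))))))) ts = Terms.var i ∷ ts
execute _ ts           = ts

-- The counter holds the odd digits read since the last complete instruction.
run : ℕᵇ → ℕ → List Term → List Term
run zero     n ts = ts
run 2[1+ k ] n ts = run k 0 (execute n ts)
run 1+[2 k ] n ts = run k (suc n) ts

run-instruction : ∀ n m k ts → run (instruction n k) m ts ≡ run k 0 (execute (n ℕ.+ m) ts)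
run-instruction zero    m k ts = ≡.refl
run-instruction (suc n) m k ts =
  ≡.trans (run-instruction n (suc m) k ts) (≡.cong (λ p → run k 0 (execute p ts)) (ℕₚ.+-suc n m))

run-encode : ∀ t k ts → run (encode t k) 0 ts ≡ run k 0 (t ∷ ts)
run-encode (s Terms.∨ t) k ts = ≡.trans (run-encode s _ ts) (run-encode t _ (s ∷ ts))
run-encode (s Terms.∧ t) k ts = ≡.trans (run-encode s _ ts) (run-encode t _ (s ∷ ts))
run-encode (t Terms.′)   k ts = run-encode t _ ts
run-encode (Terms.f t)   k ts = run-encode t _ ts
run-encode (Terms.g t)   k ts = run-encode t _ ts
run-encode Terms.0#      k ts = ≡.refl
run-encode Terms.1#      k ts = ≡.refl
-- Seven odd digits are read by computation, so the lemma starts with the counter at 7.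
run-encode (Terms.var i) k ts = ≡.trans (run-instruction i 7 k ts)
  (≡.cong (λ p → run k 0 (execute p ts)) (ℕₚ.+-comm i 7))

-- The right-hand side was pushed last. The default is an equation that holds in every algebra.
topTwo : List Term → Equation
topTwo (t ∷ s ∷ _) = s , t
topTwo _           = Terms.0# , Terms.0#

equation : ℕ → Equation
equation n = topTwo (run (fromℕ n) 0 [])

index : Equation → ℕ
index (s , t) = toℕ (encode s (encode t zero))

equation-index : ∀ e → equation (index e) ≡ e
equation-index (s , t) = begin
  topTwo (run (fromℕ (toℕ w)) 0 [])  ≡⟨ ≡.cong (λ k → topTwo (run k 0 [])) (fromℕ-toℕ w) ⟩
  topTwo (run w 0 [])                ≡⟨ ≡.cong topTwo (run-encode s _ []) ⟩
  topTwo (run (encode t zero) 0 (s ∷ []))  ≡⟨ ≡.cong topTwo (run-encode t zero (s ∷ [])) ⟩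
  s , t ∎
  where
  open ≡.≡-Reasoning
  w = encode s (encode t zero)

-- Equational logic

-- Small, unlike the axioms of a `Variety`, so that derivability can serve as the equality of an
-- `Algebra`.
Theory : Set₁
Theory = Pred Equation 0ℓ

termAlgebra : Algebra
termAlgebra = record
  { Carrier       = Term
  ; _≈_           = _≡_
  ; isEquivalence = ≡.isEquivalence
  ; _∨_           = Terms._∨_
  ; _∧_           = Terms._∧_
  ; _′            = Terms._′
  ; f             = Terms.f
  ; g             = Terms.g
  ; 0#            = Terms.0#
  ; 1#            = Terms.1#
  ; ∨-cong        = ≡.cong₂ Terms._∨_
  ; ∧-cong        = ≡.cong₂ Terms._∧_
  ; ′-cong        = ≡.cong Terms._′
  ; f-cong        = ≡.cong Terms.f
  ; g-cong        = ≡.cong Terms.g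
  }

infix 9 _[_]

_[_] : Term → (ℕ → Term) → Term
t [ σ ] = ⟦ termAlgebra ⟧ t σ

⟦⟧-subst : ∀ A t σ ρ →
           ⟦ A ⟧ (t [ σ ]) ρ ≡ ⟦ A ⟧ t (λ i → ⟦ A ⟧ (σ i) ρ)
⟦⟧-subst A (Terms.var i) σ ρ = ≡.refl
⟦⟧-subst A (s Terms.∨ t) σ ρ = ≡.cong₂ (Algebra._∨_ A) (⟦⟧-subst A s σ ρ) (⟦⟧-subst A t σ ρ)
⟦⟧-subst A (s Terms.∧ t) σ ρ = ≡.cong₂ (Algebra._∧_ A) (⟦⟧-subst A s σ ρ) (⟦⟧-subst A t σ ρ)
⟦⟧-subst A (t Terms.′)   σ ρ = ≡.cong (Algebra._′ A) (⟦⟧-subst A t σ ρ)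
⟦⟧-subst A (Terms.f t)   σ ρ = ≡.cong (Algebra.f A) (⟦⟧-subst A t σ ρ)
⟦⟧-subst A (Terms.g t)   σ ρ = ≡.cong (Algebra.g A) (⟦⟧-subst A t σ ρ)
⟦⟧-subst A Terms.0#      σ ρ = ≡.refl
⟦⟧-subst A Terms.1#      σ ρ = ≡.refl

module Derivation where

  infix 4 _⊢_≈_ _⊢_

  -- Birkhoff's equational logic, with substitution applied to axioms only.
  data _⊢_≈_ (E : Theory) : Term → Term → Set where
    axiom  : ∀ {s t} → (s , t) ∈ E → ∀ σ → E ⊢ s [ σ ] ≈ t [ σ ]
    refl   : ∀ {t} → E ⊢ t ≈ t
    sym    : ∀ {s t} → E ⊢ s ≈ t → E ⊢ t ≈ s
    trans  : ∀ {s t u} → E ⊢ s ≈ t → E ⊢ t ≈ u → E ⊢ s ≈ u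
    ∨-cong : ∀ {s t u v} → E ⊢ s ≈ t → E ⊢ u ≈ v → E ⊢ s Terms.∨ u ≈ t Terms.∨ v
    ∧-cong : ∀ {s t u v} → E ⊢ s ≈ t → E ⊢ u ≈ v → E ⊢ s Terms.∧ u ≈ t Terms.∧ v
    ′-cong : ∀ {s t} → E ⊢ s ≈ t → E ⊢ s Terms.′ ≈ t Terms.′
    f-cong : ∀ {s t} → E ⊢ s ≈ t → E ⊢ Terms.f s ≈ Terms.f t
    g-cong : ∀ {s t} → E ⊢ s ≈ t → E ⊢ Terms.g s ≈ Terms.g t

  _⊢_ : Theory → Equation → Set
  E ⊢ (s , t) = E ⊢ s ≈ t

  variety : Theory → Variety
  variety E = record { class = Mod E↑ ; axioms = E↑ ; axiomatised = id , id }
    where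
    E↑ : Pred Equation (lsuc 0ℓ)
    E↑ e = Lift _ (e ∈ E)

  sound : ∀ {E} A → (∀ e → e ∈ E → A ⊨ e) → ∀ {s t} → E ⊢ s ≈ t → A ⊨ (s , t)
  sound A A⊨E (axiom {s} {t} e∈E σ) ρ =
    ≡.subst₂ (Algebra._≈_ A) (≡.sym (⟦⟧-subst A s σ ρ)) (≡.sym (⟦⟧-subst A t σ ρ)) (A⊨E _ e∈E _)
  sound A A⊨E refl         ρ = Algebra.refl A
  sound A A⊨E (sym p)      ρ = Algebra.sym A (sound A A⊨E p ρ)
  sound A A⊨E (trans p q)  ρ = Algebra.trans A (sound A A⊨E p ρ) (sound A A⊨E q ρ)
  sound A A⊨E (∨-cong p q) ρ = Algebra.∨-cong A (sound A A⊨E p ρ) (sound A A⊨E q ρ)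
  sound A A⊨E (∧-cong p q) ρ = Algebra.∧-cong A (sound A A⊨E p ρ) (sound A A⊨E q ρ)
  sound A A⊨E (′-cong p)   ρ = Algebra.′-cong A (sound A A⊨E p ρ)
  sound A A⊨E (f-cong p)   ρ = Algebra.f-cong A (sound A A⊨E p ρ)
  sound A A⊨E (g-cong p)   ρ = Algebra.g-cong A (sound A A⊨E p ρ)

  free : Theory → Algebra
  free E = record
    { Carrier       = Term
    ; _≈_           = E ⊢_≈_
    ; isEquivalence = record { refl = refl ; sym = sym ; trans = trans }
    ; _∨_           = Terms._∨_
    ; _∧_           = Terms._∧_
    ; _′            = Terms._′
    ; f             = Terms.f
    ; g             = Terms.g
    ; 0#            = Terms.0#
    ; 1#            = Terms.1#
    ; ∨-cong        = ∨-cong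
    ; ∧-cong        = ∧-cong
    ; ′-cong        = ′-cong
    ; f-cong        = f-cong
    ; g-cong        = g-cong
    }

  ⟦⟧-free : ∀ E t σ → ⟦ free E ⟧ t σ ≡ t [ σ ]
  ⟦⟧-free E (Terms.var i) σ = ≡.refl
  ⟦⟧-free E (s Terms.∨ t) σ = ≡.cong₂ Terms._∨_ (⟦⟧-free E s σ) (⟦⟧-free E t σ)
  ⟦⟧-free E (s Terms.∧ t) σ = ≡.cong₂ Terms._∧_ (⟦⟧-free E s σ) (⟦⟧-free E t σ)
  ⟦⟧-free E (t Terms.′)   σ = ≡.cong Terms._′ (⟦⟧-free E t σ)
  ⟦⟧-free E (Terms.f t)   σ = ≡.cong Terms.f (⟦⟧-free E t σ)
  ⟦⟧-free E (Terms.g t)   σ = ≡.cong Terms.g (⟦⟧-free E t σ)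
  ⟦⟧-free E Terms.0#      σ = ≡.refl
  ⟦⟧-free E Terms.1#      σ = ≡.refl

  -- A valuation in the free algebra is a substitution, and axioms are derivable under every
  -- substitution.
  free∈variety : ∀ E → free E ∈ class (variety E)
  free∈variety E (s , t) (lift e∈E) σ =
    ≡.subst₂ (E ⊢_≈_) (≡.sym (⟦⟧-free E s σ)) (≡.sym (⟦⟧-free E t σ)) (axiom e∈E σ)

  ⊢-mono : ∀ {E E′} → E ⊆ E′ → ∀ {s t} → E ⊢ s ≈ t → E′ ⊢ s ≈ t
  ⊢-mono E⊆E′ (axiom e∈E σ) = axiom (E⊆E′ e∈E) σ
  ⊢-mono E⊆E′ refl          = refl
  ⊢-mono E⊆E′ (sym p)       = sym (⊢-mono E⊆E′ p)
  ⊢-mono E⊆E′ (trans p q)   = trans (⊢-mono E⊆E′ p) (⊢-mono E⊆E′ q)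
  ⊢-mono E⊆E′ (∨-cong p q)  = ∨-cong (⊢-mono E⊆E′ p) (⊢-mono E⊆E′ q)
  ⊢-mono E⊆E′ (∧-cong p q)  = ∧-cong (⊢-mono E⊆E′ p) (⊢-mono E⊆E′ q)
  ⊢-mono E⊆E′ (′-cong p)    = ′-cong (⊢-mono E⊆E′ p)
  ⊢-mono E⊆E′ (f-cong p)    = f-cong (⊢-mono E⊆E′ p)
  ⊢-mono E⊆E′ (g-cong p)    = g-cong (⊢-mono E⊆E′ p)

  module _ (E : ℕ → Theory) (ascending : ∀ n → E n ⊆ E (suc n)) where

    chain-mono : ∀ {m n} → m ≤ n → E m ⊆ E n
    chain-mono = go ∘ ℕₚ.≤⇒≤′
      where
      go : ∀ {m n} → m ≤′ n → E m ⊆ E n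
      go (ℕ.≤′-reflexive ≡.refl) e∈E = e∈E
      go (≤′-step m≤n)           e∈E = ascending _ (go m≤n e∈E)

    -- A derivation uses finitely many axioms, and these all occur at one stage of the chain.
    compact : ∀ {s t} → (λ e → ∃ λ n → e ∈ E n) ⊢ s ≈ t → ∃ λ n → E n ⊢ s ≈ t
    compact₂ : ∀ {s t u v} → (λ e → ∃ λ n → e ∈ E n) ⊢ s ≈ t → (λ e → ∃ λ n → e ∈ E n) ⊢ u ≈ v →
               ∃ λ n → E n ⊢ s ≈ t × E n ⊢ u ≈ v

    compact (axiom (n , e∈E) σ) = n , axiom e∈E σ
    compact refl                = 0 , refl
    compact (sym p)             = let (n , p′) = compact p in n , sym p′
    compact (trans p q)         = let (n , p′ , q′) = compact₂ p q in n , trans p′ q′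
    compact (∨-cong p q)        = let (n , p′ , q′) = compact₂ p q in n , ∨-cong p′ q′
    compact (∧-cong p q)        = let (n , p′ , q′) = compact₂ p q in n , ∧-cong p′ q′
    compact (′-cong p)          = let (n , p′) = compact p in n , ′-cong p′
    compact (f-cong p)          = let (n , p′) = compact p in n , f-cong p′
    compact (g-cong p)          = let (n , p′) = compact p in n , g-cong p′

    compact₂ p q with compact p | compact q
    ... | m , p′ | n , q′ = m ℕ.⊔ n
      , ⊢-mono (chain-mono (ℕₚ.m≤m⊔n m n)) p′ , ⊢-mono (chain-mono (ℕₚ.m≤n⊔m m n)) q′

open Derivation hiding
  (refl; sym; trans; ∨-cong; ∧-cong; ′-cong; f-cong; g-cong)

-- Lindenbaum's construction: decide the equations one after another, adding
-- each that does not make the given one derivable.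
module Lindenbaum (target : Equation) where

  stage : Theory → ℕ → Theory
  stage E zero    = E
  stage E (suc n) = stage E n ∪
    λ e → e ≡ equation n × ¬ (stage E n ∪ ｛ e ｝) ⊢ target

  completion : Theory → Theory
  completion E e = ∃ λ n → e ∈ stage E n

  -- The test in `stage` is a negation, so carrying it over uses the reverse inclusion. This lets a
  -- cover depend on its sequence only up to pointwise equality.
  stage-cong : ∀ {E E′} → E ⊆ E′ → E′ ⊆ E → ∀ n → stage E n ⊆ stage E′ n
  stage-cong E⊆E′ E′⊆E zero    = E⊆E′
  stage-cong E⊆E′ E′⊆E (suc n) = Sum.map (stage-cong E⊆E′ E′⊆E n)
    λ (e≡ , ⊬target) → e≡ , ⊬target ∘ ⊢-mono (Sum.map (stage-cong E′⊆E E⊆E′ n) id)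

  completion-cong : ∀ {E E′} → E ⊆ E′ → E′ ⊆ E → completion E ⊆ completion E′
  completion-cong E⊆E′ E′⊆E (n , e∈) = n , stage-cong E⊆E′ E′⊆E n e∈

  stage-consistent : ∀ {E} → ¬ E ⊢ target → ∀ n → ¬ stage E n ⊢ target
  stage-consistent ⊬target zero    = ⊬target
  stage-consistent {E} ⊬target (suc n) ⊢target =
    stage-consistent ⊬target n (⊢-mono drop ⊢target)
    where
    drop : stage E (suc n) ⊆ stage E n
    drop (inj₁ e∈)                  = e∈
    -- The new stage lies in the old one with this equation added, so the test had ruled out the
    -- derivation.
    drop (inj₂ (≡.refl , excluded)) = contradiction
      (⊢-mono (Sum.map₂ λ (d≡e , _) → ≡.sym d≡e) ⊢target) excluded

  completion-consistent : ∀ {E} → ¬ E ⊢ target → ¬ completion E ⊢ target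
  completion-consistent ⊬target ⊢target =
    let (n , p) = compact _ (λ _ → inj₁) ⊢target in stage-consistent ⊬target n p

  -- The equation was tried at its own index and can only have been rejected for making `target`
  -- derivable.
  completion-maximal : (∀ {ℓ} → ExcludedMiddle ℓ) → ∀ {E e} → e ∉ completion E →
                       (completion E ∪ ｛ e ｝) ⊢ target
  completion-maximal em {E} {e} e∉ = ⊢-mono (Sum.map₁ (n ,_))
    (decidable-stable em λ ⊬target → e∉ (suc n , inj₂ (≡.sym (equation-index e) , ⊬target)))
    where n = index e

-- Tense algebras and T₀

bound : Term → ℕ
bound (Terms.var i) = suc i
bound (s Terms.∨ t) = bound s ℕ.⊔ bound t
bound (s Terms.∧ t) = bound s ℕ.⊔ bound t
bound (t Terms.′)   = bound t
bound (Terms.f t)   = bound t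
bound (Terms.g t)   = bound t
bound Terms.0#      = 0
bound Terms.1#      = 0

module _ (A : Algebra) where
  open Algebra A

  ⟦⟧-local : ∀ t {ρ σ} → (∀ i → i < bound t → ρ i ≈ σ i) → ⟦ A ⟧ t ρ ≈ ⟦ A ⟧ t σ
  ⟦⟧-local (Terms.var i) ρ≈σ = ρ≈σ i ℕₚ.≤-refl
  ⟦⟧-local (s Terms.∨ t) ρ≈σ = ∨-cong
    (⟦⟧-local s λ i i< → ρ≈σ i (ℕₚ.m≤n⇒m≤n⊔o _ i<)) (⟦⟧-local t λ i i< → ρ≈σ i (ℕₚ.m≤n⇒m≤o⊔n _ i<))
  ⟦⟧-local (s Terms.∧ t) ρ≈σ = ∧-cong
    (⟦⟧-local s λ i i< → ρ≈σ i (ℕₚ.m≤n⇒m≤n⊔o _ i<)) (⟦⟧-local t λ i i< → ρ≈σ i (ℕₚ.m≤n⇒m≤o⊔n _ i<))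
  ⟦⟧-local (t Terms.′)   ρ≈σ = ′-cong (⟦⟧-local t ρ≈σ)
  ⟦⟧-local (Terms.f t)   ρ≈σ = f-cong (⟦⟧-local t ρ≈σ)
  ⟦⟧-local (Terms.g t)   ρ≈σ = g-cong (⟦⟧-local t ρ≈σ)
  ⟦⟧-local Terms.0#      ρ≈σ = refl
  ⟦⟧-local Terms.1#      ρ≈σ = refl

module Tense {A : Algebra} (tense : IsTenseAlgebra A) where
  open Algebra A public
  open IsTenseAlgebra tense public

  booleanAlgebra : BooleanAlgebra 0ℓ 0ℓ
  booleanAlgebra = record { isBooleanAlgebra = isBooleanAlgebra }

  open BooleanAlgebra booleanAlgebra public
    using ( ∧-comm; ∧-assoc; ∧-congˡ; ∧-congʳ; ∨-congˡ
          ; ∧-distribˡ-∨; ∧-distribʳ-∨; ∧-complementʳ; ∧-complementˡ; ∨-complementʳ)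
  open BooleanAlgebraProperties booleanAlgebra public
    using ( ∧-identityʳ; ∧-identityˡ; ∧-zeroˡ; ∧-zeroʳ; ∨-identityʳ; ∨-identityˡ; ∧-idem; ∨-idem
          ; ∨-zeroˡ; ¬⊥≈⊤; ¬⊤≈⊥; deMorgan₁)
  open SetoidReasoning setoid public

  f0≈0 : f 0# ≈ 0#
  f0≈0 = trans (sym (∧-identityʳ _)) (Equivalence.from (conjugate 0# 1#) (∧-zeroˡ _))

  g0≈0 : g 0# ≈ 0#
  g0≈0 = trans (sym (∧-identityˡ _)) (Equivalence.to (conjugate 1# 0#) (∧-zeroʳ _))

  split : ∀ b {x y} → x ∧ b ≈ y ∧ b → x ∧ b ′ ≈ y ∧ b ′ → x ≈ y
  split b {x} {y} p q = begin
    x                  ≈⟨ parts x ⟩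
    x ∧ b ∨ x ∧ b ′    ≈⟨ ∨-cong p q ⟩
    y ∧ b ∨ y ∧ b ′    ≈⟨ parts y ⟨
    y                  ∎
    where
    parts : ∀ z → z ≈ z ∧ b ∨ z ∧ b ′
    parts z = begin
      z                ≈⟨ ∧-identityʳ z ⟨
      z ∧ 1#           ≈⟨ ∧-congˡ (∨-complementʳ b) ⟨
      z ∧ (b ∨ b ′)    ≈⟨ ∧-distribˡ-∨ z b (b ′) ⟩
      z ∧ b ∨ z ∧ b ′  ∎

  fromBool : Bool → Carrier
  fromBool b = if b then 1# else 0#

  module _ (f1≈1 : f 1# ≈ 1#) (g1≈1 : g 1# ≈ 1#) where

    fromBool-⟦⟧ : ∀ t ρ → ⟦ A ⟧ t (fromBool ∘ ρ) ≈ fromBool (⟦ T₀ ⟧ t ρ)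
    fromBool-⟦⟧ (Terms.var i) ρ = refl
    fromBool-⟦⟧ (s Terms.∨ t) ρ = trans (∨-cong (fromBool-⟦⟧ s ρ) (fromBool-⟦⟧ t ρ))
                                        (homo (⟦ T₀ ⟧ s ρ) (⟦ T₀ ⟧ t ρ))
      where
      homo : ∀ a b → fromBool a ∨ fromBool b ≈ fromBool (a Bool.∨ b)
      homo false b = ∨-identityˡ _
      homo true  b = ∨-zeroˡ _
    fromBool-⟦⟧ (s Terms.∧ t) ρ = trans (∧-cong (fromBool-⟦⟧ s ρ) (fromBool-⟦⟧ t ρ))
                                        (homo (⟦ T₀ ⟧ s ρ) (⟦ T₀ ⟧ t ρ))
      where
      homo : ∀ a b → fromBool a ∧ fromBool b ≈ fromBool (a Bool.∧ b)
      homo false b = ∧-zeroˡ _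
      homo true  b = ∧-identityˡ _
    fromBool-⟦⟧ (t Terms.′)   ρ = trans (′-cong (fromBool-⟦⟧ t ρ)) (homo (⟦ T₀ ⟧ t ρ))
      where
      homo : ∀ a → fromBool a ′ ≈ fromBool (not a)
      homo false = ¬⊥≈⊤
      homo true  = ¬⊤≈⊥
    fromBool-⟦⟧ (Terms.f t)   ρ = trans (f-cong (fromBool-⟦⟧ t ρ)) (homo (⟦ T₀ ⟧ t ρ))
      where
      homo : ∀ a → f (fromBool a) ≈ fromBool a
      homo false = f0≈0
      homo true  = f1≈1
    fromBool-⟦⟧ (Terms.g t)   ρ = trans (g-cong (fromBool-⟦⟧ t ρ)) (homo (⟦ T₀ ⟧ t ρ))
      where
      homo : ∀ a → g (fromBool a) ≈ fromBool a
      homo false = g0≈0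
      homo true  = g1≈1
    fromBool-⟦⟧ Terms.0#      ρ = refl
    fromBool-⟦⟧ Terms.1#      ρ = refl

    -- The two-element subalgebra of a nontrivial algebra is a copy of T₀.
    T₀-satisfies : ¬ (∀ x y → x ≈ y) → ∀ {e} → A ⊨ e → T₀ ⊨ e
    T₀-satisfies nontrivial {s , t} A⊨e ρ = injective _ _ (begin
      fromBool (⟦ T₀ ⟧ s ρ)      ≈⟨ fromBool-⟦⟧ s ρ ⟨
      ⟦ A ⟧ s (fromBool ∘ ρ)     ≈⟨ A⊨e _ ⟩
      ⟦ A ⟧ t (fromBool ∘ ρ)     ≈⟨ fromBool-⟦⟧ t ρ ⟩
      fromBool (⟦ T₀ ⟧ t ρ)      ∎)
      where
      0≉1 : ¬ 0# ≈ 1#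
      0≉1 0≈1 = nontrivial λ x y → trans (collapse x) (sym (collapse y))
        where
        collapse : ∀ x → x ≈ 0#
        collapse x = trans (sym (∧-identityʳ x)) (trans (∧-congˡ (sym 0≈1)) (∧-zeroʳ x))

      injective : ∀ a b → fromBool a ≈ fromBool b → a ≡ b
      injective false false _ = ≡.refl
      injective false true  p = contradiction p 0≉1
      injective true  false p = contradiction (sym p) 0≉1
      injective true  true  _ = ≡.refl

  module _ (f-id : ∀ x → f x ≈ x) where

    -- The identity is conjugate to itself, and an operator has at most one conjugate.
    g-id : ∀ y → g y ≈ y
    g-id y = split y
      (trans (∧-comm _ _) (trans y≤gy (sym (∧-idem y))))
      (trans (∧-comm _ _) (trans y′∧gy≈0 (sym (∧-complementʳ y))))
      where
      y′∧gy≈0 : y ′ ∧ g y ≈ 0#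
      y′∧gy≈0 = Equivalence.to (conjugate (y ′) y) (trans (∧-congʳ (f-id _)) (∧-complementˡ y))

      y∧gy′≈0 : y ∧ g y ′ ≈ 0#
      y∧gy′≈0 = trans (∧-comm _ _) (trans (∧-congʳ (sym (f-id _)))
        (Equivalence.from (conjugate (g y ′) y) (∧-complementˡ _)))

      y≤gy : y ∧ g y ≈ y
      y≤gy = begin
        y ∧ g y                 ≈⟨ ∨-identityʳ _ ⟨
        y ∧ g y ∨ 0#            ≈⟨ ∨-congˡ y∧gy′≈0 ⟨
        y ∧ g y ∨ y ∧ g y ′     ≈⟨ ∧-distribˡ-∨ _ _ _ ⟨
        y ∧ (g y ∨ g y ′)       ≈⟨ ∧-congˡ (∨-complementʳ _) ⟩
        y ∧ 1#                  ≈⟨ ∧-identityʳ y ⟩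
        y                       ∎

    ∨-relativize : ∀ b x y → (x ∨ y) ∧ b ≈ x ∧ b ∨ y ∧ b
    ∨-relativize b x y = ∧-distribʳ-∨ b x y

    ∧-relativize : ∀ b x y → (x ∧ y) ∧ b ≈ (x ∧ b) ∧ (y ∧ b)
    ∧-relativize b x y = sym (begin
      (x ∧ b) ∧ (y ∧ b)   ≈⟨ ∧-congˡ (∧-comm y b) ⟩
      (x ∧ b) ∧ (b ∧ y)   ≈⟨ ∧-assoc x b (b ∧ y) ⟩
      x ∧ (b ∧ (b ∧ y))   ≈⟨ ∧-congˡ (∧-assoc b b y) ⟨
      x ∧ ((b ∧ b) ∧ y)   ≈⟨ ∧-congˡ (∧-congʳ (∧-idem b)) ⟩
      x ∧ (b ∧ y)         ≈⟨ ∧-congˡ (∧-comm b y) ⟩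
      x ∧ (y ∧ b)         ≈⟨ ∧-assoc x y b ⟨
      (x ∧ y) ∧ b         ∎)

    ′-relativize : ∀ b x → x ′ ∧ b ≈ (x ∧ b) ′ ∧ b
    ′-relativize b x = sym (begin
      (x ∧ b) ′ ∧ b           ≈⟨ ∧-congʳ (deMorgan₁ x b) ⟩
      (x ′ ∨ b ′) ∧ b         ≈⟨ ∧-distribʳ-∨ b (x ′) (b ′) ⟩
      x ′ ∧ b ∨ b ′ ∧ b       ≈⟨ ∨-congˡ (∧-complementˡ b) ⟩
      x ′ ∧ b ∨ 0#            ≈⟨ ∨-identityʳ _ ⟩
      x ′ ∧ b                 ∎)

    -- All operations are now Boolean or the identity, so meeting with `b` is a homomorphism onto
    -- the interval below `b`.
    ⟦⟧-relativize : ∀ b {ρ σ} → (∀ i → ρ i ∧ b ≈ σ i ∧ b) →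
                    ∀ t → ⟦ A ⟧ t ρ ∧ b ≈ ⟦ A ⟧ t σ ∧ b
    ⟦⟧-relativize b ρ≈σ (Terms.var i) = ρ≈σ i
    ⟦⟧-relativize b ρ≈σ (s Terms.∨ t) = trans (∨-relativize b _ _)
      (trans (∨-cong (⟦⟧-relativize b ρ≈σ s) (⟦⟧-relativize b ρ≈σ t)) (sym (∨-relativize b _ _)))
    ⟦⟧-relativize b ρ≈σ (s Terms.∧ t) = trans (∧-relativize b _ _)
      (trans (∧-cong (⟦⟧-relativize b ρ≈σ s) (⟦⟧-relativize b ρ≈σ t)) (sym (∧-relativize b _ _)))
    ⟦⟧-relativize b ρ≈σ (t Terms.′)   = trans (′-relativize b _)
      (trans (∧-congʳ (′-cong (⟦⟧-relativize b ρ≈σ t))) (sym (′-relativize b _)))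
    ⟦⟧-relativize b ρ≈σ (Terms.f t)   = trans (∧-congʳ (f-id _))
      (trans (⟦⟧-relativize b ρ≈σ t) (sym (∧-congʳ (f-id _))))
    ⟦⟧-relativize b ρ≈σ (Terms.g t)   = trans (∧-congʳ (g-id _))
      (trans (⟦⟧-relativize b ρ≈σ t) (sym (∧-congʳ (g-id _))))
    ⟦⟧-relativize b ρ≈σ Terms.0#      = refl
    ⟦⟧-relativize b ρ≈σ Terms.1#      = refl

    _[_≔_] : (ℕ → Carrier) → ℕ → Carrier → ℕ → Carrier
    (ρ [ n ≔ c ]) i with i ℕₚ.≟ n
    ... | yes _ = c
    ... | no _  = ρ i

    module _ {s t} (T₀⊨s≈t : T₀ ⊨ (s , t)) where

      -- Shannon expansion: below ρ n the variable n behaves as 1#, and below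
      -- the complement of ρ n as 0#.
      satisfies-two-valued : ∀ n ρ → (∀ i → n ≤ i → ∃ λ b → ρ i ≈ fromBool b) →
                             ⟦ A ⟧ s ρ ≈ ⟦ A ⟧ t ρ
      satisfies-two-valued zero ρ two = begin
        ⟦ A ⟧ s ρ                ≈⟨ ⟦⟧-local A s ρ≈β ⟩
        ⟦ A ⟧ s (fromBool ∘ β)   ≈⟨ fromBool-⟦⟧ (f-id 1#) (g-id 1#) s β ⟩
        fromBool (⟦ T₀ ⟧ s β)    ≡⟨ ≡.cong fromBool (T₀⊨s≈t β) ⟩
        fromBool (⟦ T₀ ⟧ t β)    ≈⟨ fromBool-⟦⟧ (f-id 1#) (g-id 1#) t β ⟨
        ⟦ A ⟧ t (fromBool ∘ β)   ≈⟨ ⟦⟧-local A t ρ≈β ⟨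
        ⟦ A ⟧ t ρ                ∎
        where
        β : ℕ → Bool
        β i = proj₁ (two i z≤n)
        ρ≈β : ∀ {n} i → i < n → ρ i ≈ fromBool (β i)
        ρ≈β i _ = proj₂ (two i z≤n)
      satisfies-two-valued (suc n) ρ two = split (ρ n)
        (via (ρ n) true (trans (∧-idem _) (sym (∧-identityˡ _))))
        (via (ρ n ′) false (trans (∧-complementʳ _) (sym (∧-zeroˡ _))))
        where
        via : ∀ b v → ρ n ∧ b ≈ fromBool v ∧ b → ⟦ A ⟧ s ρ ∧ b ≈ ⟦ A ⟧ t ρ ∧ b
        via b v eq = trans (⟦⟧-relativize b same s)
          (trans (∧-congʳ (satisfies-two-valued n (ρ [ n ≔ fromBool v ]) two′))
                 (sym (⟦⟧-relativize b same t)))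
          where
          same : ∀ i → ρ i ∧ b ≈ (ρ [ n ≔ fromBool v ]) i ∧ b
          same i with i ℕₚ.≟ n
          ... | yes ≡.refl = eq
          ... | no _       = refl

          two′ : ∀ i → n ≤ i → ∃ λ b → (ρ [ n ≔ fromBool v ]) i ≈ fromBool b
          two′ i n≤i with i ℕₚ.≟ n
          ... | yes _  = v , refl
          ... | no i≢n = two i (ℕₚ.≤∧≢⇒< n≤i (i≢n ∘ ≡.sym))

      satisfies-identity : A ⊨ (s , t)
      satisfies-identity ρ = trans (⟦⟧-local A s (λ i i< → sym (short i (ℕₚ.m≤n⇒m≤n⊔o _ i<))))
        (trans (satisfies-two-valued n ρ′ two)
               (⟦⟧-local A t (λ i i< → short i (ℕₚ.m≤n⇒m≤o⊔n _ i<))))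
        where
        n = bound s ℕ.⊔ bound t
        -- Variables beyond both terms default to `0#`, so that only finitely many are left to
        -- expand.
        ρ′ : ℕ → Carrier
        ρ′ i with i ℕₚ.<? n
        ... | yes _ = ρ i
        ... | no _  = 0#
        short : ∀ i → i < n → ρ′ i ≈ ρ i
        short i i<n with i ℕₚ.<? n
        ... | yes _  = refl
        ... | no i≮n = contradiction i<n i≮n
        two : ∀ i → n ≤ i → ∃ λ b → ρ′ i ≈ fromBool b
        two i n≤i with i ℕₚ.<? n
        ... | yes i<n = contradiction i<n (ℕₚ.≤⇒≯ n≤i)
        ... | no _    = false , refl

    ∈VarT₀ : A ∈ class VarT₀
    ∈VarT₀ (s , t) e∈Id = satisfies-identity {s} {t} (e∈Id T₀ ≡.refl)

-- The algebra of a binary sequence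

true≢false : ¬ true ≡ false
true≢false ()

≢true⇒≡false : ∀ {b} → ¬ b ≡ true → b ≡ false
≢true⇒≡false {false} _ = ≡.refl
≢true⇒≡false {true}  p = contradiction ≡.refl p

true⇔true⇒≡ : ∀ {a b} → (a ≡ true → b ≡ true) → (b ≡ true → a ≡ true) → a ≡ b
true⇔true⇒≡ {false} {false} p q = ≡.refl
true⇔true⇒≡ {false} {true}  p q = q ≡.refl
true⇔true⇒≡ {true}  {b}     p q = ≡.sym (p ≡.refl)

∧-true : ∀ {a b} → a Bool.∧ b ≡ true → a ≡ true × b ≡ true
∧-true {true} {true} _ = ≡.refl , ≡.refl

∨-true : ∀ {a b} → a Bool.∨ b ≡ true → a ≡ true ⊎ b ≡ true
∨-true {true}  _ = inj₁ ≡.refl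
∨-true {false} p = inj₂ p

not-true : ∀ {a} → not a ≡ true → ¬ a ≡ true
not-true {false} _ ()

true-not : ∀ {a} → ¬ a ≡ true → not a ≡ true
true-not p = ≡.cong not (≢true⇒≡false p)

2+n≰n : ∀ {n} → ¬ 2 ℕ.+ n ≤ n
2+n≰n = ℕₚ.1+n≰n ∘ ℕₚ.≤-trans (ℕₚ.n≤1+n _)

World : Set
World = ℕ × ℕ

-- The first component of a world is its level. The digit w n is stored, on every
-- level k, in whether (k , n + 2) ↝ (k , 0). The algebra of w is the complex
-- algebra of the reflexive total relations ¬ u ↝ v and ¬ v ↝ u, restricted to
-- the sets that contain all or none of the sufficiently high levels.
infix 4 _⊢_↝_
data _⊢_↝_ (w : ℕ → Bool) : World → World → Set where
  far  : ∀ {k a l b} → 2 ℕ.+ k ≤ l → w ⊢ (k , a) ↝ (l , b)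
  next : ∀ {k a} → w ⊢ (k , a) ↝ (suc k , 0)
  step : ∀ {k a} → w ⊢ (k , a) ↝ (k , suc a)
  code : ∀ {k n} → w n ≡ true → w ⊢ (k , 2 ℕ.+ n) ↝ (k , 0)

↝-level : ∀ {w u v} → w ⊢ u ↝ v → proj₁ u ≤ proj₁ v
↝-level (far k+2≤l) = ℕₚ.≤-trans (ℕₚ.m≤n+m _ 2) k+2≤l
↝-level next        = ℕₚ.n≤1+n _
↝-level step        = ℕₚ.≤-refl
↝-level (code _)    = ℕₚ.≤-refl

-- This is what makes the algebra total. The offset 2 in `code` prevents it from reversing a `step`.
↝-asym : ∀ {w u v} → w ⊢ u ↝ v → ¬ w ⊢ v ↝ u
↝-asym (far k+2≤l) q = 2+n≰n (ℕₚ.≤-trans k+2≤l (↝-level q))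
↝-asym next        q = ℕₚ.1+n≰n (↝-level q)
↝-asym step (far k+2≤k) = 2+n≰n k+2≤k
↝-asym (code _) (far k+2≤k) = 2+n≰n k+2≤k

↝-irrefl : ∀ {w u} → ¬ w ⊢ u ↝ u
↝-irrefl p = ↝-asym p p

↝-cong : ∀ {w w′} → w ≗ w′ → ∀ {u v} → w ⊢ u ↝ v → w′ ⊢ u ↝ v
↝-cong w≗w′ (far p)  = far p
↝-cong w≗w′ next     = next
↝-cong w≗w′ step     = step
↝-cong w≗w′ (code p) = code (≡.trans (≡.sym (w≗w′ _)) p)

-- Of a set and its complement, one thus meets only finitely many levels; if nonempty, it has a
-- highest level.
EventuallyConstant : (World → Bool) → Set
EventuallyConstant X = Σ Bool λ c → ∃ λ N → ∀ k a → N ≤ k → X (k , a) ≡ c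

-- Complex algebras

module Complex (em : ∀ {ℓ} → ExcludedMiddle ℓ) where

  ◇ : (World → World → Set) → (World → Bool) → World → Bool
  ◇ R X u = does (em {P = ∃ λ v → X v ≡ true × R u v})

  ◇-elim : ∀ R {X u} → ◇ R X u ≡ true → ∃ λ v → X v ≡ true × R u v
  ◇-elim R {X} {u} p with em {P = ∃ λ v → X v ≡ true × R u v}
  ... | yes q = q

  ◇-intro : ∀ R {X u} → (∃ λ v → X v ≡ true × R u v) → ◇ R X u ≡ true
  ◇-intro R {X} {u} q with em {P = ∃ λ v → X v ≡ true × R u v}
  ... | yes _ = ≡.refl
  ... | no ¬q = contradiction q ¬q

  ◇-cong : ∀ R R′ {X Y} → (∀ {u v} → R u v → R′ u v) → (∀ {u v} → R′ u v → R u v) →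
           X ≗ Y → ◇ R X ≗ ◇ R′ Y
  ◇-cong R R′ R⇒R′ R′⇒R X≗Y u = true⇔true⇒≡
    (λ p → let (v , v∈X , r) = ◇-elim R p in ◇-intro R′ (v , ≡.trans (≡.sym (X≗Y v)) v∈X , R⇒R′ r))
    (λ p → let (v , v∈Y , r) = ◇-elim R′ p in ◇-intro R (v , ≡.trans (X≗Y v) v∈Y , R′⇒R r))

  -- A world of `X` that the converse of `R` relates to a world of `Y` puts the latter into `◇ R X`.
  ◇-conjugate : ∀ R {X Y} → (∀ u → ◇ R X u Bool.∧ Y u ≡ false) →
                ∀ u → X u Bool.∧ ◇ (flip R) Y u ≡ false
  ◇-conjugate R disjoint u = ≢true⇒≡false λ p →
    let (u∈X , q) = ∧-true p
        (v , v∈Y , Rvu) = ◇-elim (flip R) q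
    in true≢false (≡.trans (≡.sym (≡.cong₂ Bool._∧_ (◇-intro R (u , u∈X , Rvu)) v∈Y)) (disjoint v))

  module _ (w : ℕ → Bool) where

    Fᶠ Fᵍ : World → World → Set
    Fᶠ u v = ¬ w ⊢ u ↝ v
    Fᵍ u v = ¬ w ⊢ v ↝ u

    -- Reflexivity keeps the high levels of `X`. As `↝` never leads down, each world of `X` also
    -- puts all higher levels into the result.
    f-eventually : ∀ {X} → EventuallyConstant X → EventuallyConstant (◇ Fᶠ X)
    f-eventually (true , N , const) = true , N , λ k a N≤k →
      ◇-intro Fᶠ ((k , a) , const k a N≤k , ↝-irrefl)
    f-eventually {X} (false , N , const) with em {P = ∃ λ v → X v ≡ true}
    ... | yes ((l , b) , v∈X) = true , suc l , λ k a l<k →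
      ◇-intro Fᶠ ((l , b) , v∈X , λ p → ℕₚ.<⇒≱ l<k (↝-level p))
    ... | no none = false , 0 , λ k a _ → ≢true⇒≡false λ p →
      let (v , v∈X , _) = ◇-elim Fᶠ p in none (v , v∈X)

    g-eventually : ∀ {X} → EventuallyConstant X → EventuallyConstant (◇ Fᵍ X)
    g-eventually (true , N , const) = true , N , λ k a N≤k →
      ◇-intro Fᵍ ((k , a) , const k a N≤k , ↝-irrefl)
    -- Worlds of `X` lie below level `N`, hence at least two levels below `k`, and `far` applies.
    g-eventually {X} (false , N , const) = false , suc N , λ k a N<k → ≢true⇒≡false λ p →
      let ((l , b) , v∈X , ¬r) = ◇-elim Fᵍ p in
      ¬r (far (ℕₚ.≤-trans
        (s≤s (ℕₚ.≰⇒> λ N≤l → true≢false (≡.trans (≡.sym v∈X) (const l b N≤l)))) N<k))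

    private
      module B = IsBooleanAlgebra Boolₚ.∨-∧-isBooleanAlgebra

    algebra : Algebra
    algebra = record
      { Carrier       = Σ (World → Bool) EventuallyConstant
      ; _≈_           = λ X Y → proj₁ X ≗ proj₁ Y
      ; isEquivalence = record
        { refl  = λ _ → ≡.refl
        ; sym   = λ p u → ≡.sym (p u)
        ; trans = λ p q u → ≡.trans (p u) (q u)
        }
      ; _∨_ = λ (X , c , M , p) (Y , d , N , q) →
          (λ u → X u Bool.∨ Y u) , c Bool.∨ d , M ℕ.⊔ N , λ k a M⊔N≤k →
            ≡.cong₂ Bool._∨_ (p k a (ℕₚ.m⊔n≤o⇒m≤o M N M⊔N≤k)) (q k a (ℕₚ.m⊔n≤o⇒n≤o M N M⊔N≤k))
      ; _∧_ = λ (X , c , M , p) (Y , d , N , q) →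
          (λ u → X u Bool.∧ Y u) , c Bool.∧ d , M ℕ.⊔ N , λ k a M⊔N≤k →
            ≡.cong₂ Bool._∧_ (p k a (ℕₚ.m⊔n≤o⇒m≤o M N M⊔N≤k)) (q k a (ℕₚ.m⊔n≤o⇒n≤o M N M⊔N≤k))
      ; _′ = λ (X , c , N , p) → not ∘ X , not c , N , λ k a N≤k → ≡.cong not (p k a N≤k)
      ; f = λ (X , p) → ◇ Fᶠ X , f-eventually p
      ; g = λ (X , p) → ◇ Fᵍ X , g-eventually p
      ; 0# = (λ _ → false) , false , 0 , λ _ _ _ → ≡.refl
      ; 1# = (λ _ → true) , true , 0 , λ _ _ _ → ≡.refl
      ; ∨-cong = λ p q u → ≡.cong₂ Bool._∨_ (p u) (q u)
      ; ∧-cong = λ p q u → ≡.cong₂ Bool._∧_ (p u) (q u)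
      ; ′-cong = λ p u → ≡.cong not (p u)
      ; f-cong = ◇-cong Fᶠ Fᶠ id id
      ; g-cong = ◇-cong Fᵍ Fᵍ id id
      }

    open Algebra algebra

    isTense : IsTenseAlgebra algebra
    isTense = record
      { isBooleanAlgebra = record
        { isDistributiveLattice = record
          { isLattice = record
            { isEquivalence = isEquivalence
            ; ∨-comm     = λ X Y u → B.∨-comm (proj₁ X u) (proj₁ Y u)
            ; ∨-assoc    = λ X Y Z u → B.∨-assoc (proj₁ X u) (proj₁ Y u) (proj₁ Z u)
            ; ∨-cong     = λ {x} {y} {z} {v} → ∨-cong {x} {y} {z} {v}
            ; ∧-comm     = λ X Y u → B.∧-comm (proj₁ X u) (proj₁ Y u)
            ; ∧-assoc    = λ X Y Z u → B.∧-assoc (proj₁ X u) (proj₁ Y u) (proj₁ Z u)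
            ; ∧-cong     = λ {x} {y} {z} {v} → ∧-cong {x} {y} {z} {v}
            ; absorptive = (λ X Y u → B.∨-absorbs-∧ (proj₁ X u) (proj₁ Y u))
                         , (λ X Y u → B.∧-absorbs-∨ (proj₁ X u) (proj₁ Y u))
            }
          ; ∨-distrib-∧ = (λ X Y Z u → B.∨-distribˡ-∧ (proj₁ X u) (proj₁ Y u) (proj₁ Z u))
                        , (λ X Y Z u → B.∨-distribʳ-∧ (proj₁ X u) (proj₁ Y u) (proj₁ Z u))
          ; ∧-distrib-∨ = (λ X Y Z u → B.∧-distribˡ-∨ (proj₁ X u) (proj₁ Y u) (proj₁ Z u))
                        , (λ X Y Z u → B.∧-distribʳ-∨ (proj₁ X u) (proj₁ Y u) (proj₁ Z u))
          }
        ; ∨-complement = (λ X u → B.∨-complementˡ (proj₁ X u))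
                       , (λ X u → B.∨-complementʳ (proj₁ X u))
        ; ∧-complement = (λ X u → B.∧-complementˡ (proj₁ X u))
                       , (λ X u → B.∧-complementʳ (proj₁ X u))
        ; ¬-cong = λ {x} {y} → ′-cong {x} {y}
        }
      ; conjugate = λ (X , _) (Y , _) → mk⇔
          (◇-conjugate Fᶠ)
          (λ p u → ≡.trans (B.∧-comm (◇ Fᶠ X u) (Y u))
            (◇-conjugate Fᵍ {Y} {X} (λ v → ≡.trans (B.∧-comm (◇ Fᵍ Y v) (X v)) (p v)) u))
      }

    isTotal : IsTotal algebra
    isTotal (X , _) X≉0 u with em {P = ∃ λ v → X v ≡ true}
    ... | no none = contradiction (λ v → ≢true⇒≡false λ v∈X → none (v , v∈X)) X≉0
    ... | yes (v , v∈X) with em {P = w ⊢ u ↝ v}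
    ...   | no ¬u↝v = ≡.cong (Bool._∨ ◇ Fᵍ X u) (◇-intro Fᶠ (v , v∈X , ¬u↝v))
    ...   | yes u↝v = ≡.trans (≡.cong (◇ Fᶠ X u Bool.∨_) (◇-intro Fᵍ (v , v∈X , ↝-asym u↝v)))
                              (Boolₚ.∨-zeroʳ (◇ Fᶠ X u))

  -- The carrier does not depend on the sequence, so one valuation serves both algebras.
  algebra-cong : ∀ {w w′} → w ≗ w′ → ∀ t ρ →
                 proj₁ (⟦ algebra w ⟧ t ρ) ≗ proj₁ (⟦ algebra w′ ⟧ t ρ)
  algebra-cong w≗w′ (Terms.var i) ρ u = ≡.refl
  algebra-cong w≗w′ (s Terms.∨ t) ρ u =
    ≡.cong₂ Bool._∨_ (algebra-cong w≗w′ s ρ u) (algebra-cong w≗w′ t ρ u)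
  algebra-cong w≗w′ (s Terms.∧ t) ρ u =
    ≡.cong₂ Bool._∧_ (algebra-cong w≗w′ s ρ u) (algebra-cong w≗w′ t ρ u)
  algebra-cong w≗w′ (t Terms.′)   ρ u = ≡.cong not (algebra-cong w≗w′ t ρ u)
  algebra-cong {w} {w′} w≗w′ (Terms.f t) ρ =
    ◇-cong (Fᶠ w) (Fᶠ w′) (_∘ ↝-cong (≡.sym ∘ w≗w′)) (_∘ ↝-cong w≗w′) (algebra-cong w≗w′ t ρ)
  algebra-cong {w} {w′} w≗w′ (Terms.g t) ρ =
    ◇-cong (Fᵍ w) (Fᵍ w′) (_∘ ↝-cong (≡.sym ∘ w≗w′)) (_∘ ↝-cong w≗w′) (algebra-cong w≗w′ t ρ)
  algebra-cong w≗w′ Terms.0#      ρ u = ≡.refl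
  algebra-cong w≗w′ Terms.1#      ρ u = ≡.refl

-- Terms that read off the digits

-- In the algebra of a sequence, u is in pred t iff u ↝ v for all v in t, and in
-- succ t iff v ↝ u for all v in t.
pred succ : Term → Term
pred t = Terms.f t Terms.′
succ t = Terms.g t Terms.′

top : Term → Term
top t = Terms.g (Terms.g t)

-- If M is the highest level met by x, then t = top x consists of the levels up
-- to M + 1 and of all (M + 2 , a + 1). In that case below t, below (below t),
-- upto t, centre t, arm t and point n t are the levels up to M + 1, those up to
-- M, the latter with all (M + 1 , a + 1), {(M + 1 , 0)}, {(M + 1 , a + 1)} for
-- all a, and {(M + 1 , n)}.
below upto centre arm : Term → Term
below  t = pred (t Terms.′)
upto   t = succ (below (below t)) Terms.′
centre t = below t Terms.∧ upto t Terms.′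
arm    t = upto t Terms.∧ below (below t) Terms.′

point : ℕ → Term → Term
point zero    t = centre t
point (suc n) t = succ (point n t) Terms.∧ arm t

-- In a total tense algebra this sends 0 to 0 and everything else to 1.
somewhere : Term → Term
somewhere t = Terms.f t Terms.∨ Terms.g t

-- For `t` as above, nonempty exactly if the `code` pair for `n` is present on level M + 1.
bit : ℕ → Term → Term
bit n t = point (2 ℕ.+ n) t Terms.∧ pred (centre t)

digit : ℕ → Term → Term
digit n t = somewhere (bit n (top t))

-- Evaluation of the digit terms

module Forcing (em : ∀ {ℓ} → ExcludedMiddle ℓ) (w : ℕ → Bool) where
  open Complex em

  private
    A = algebra w

  module _ (ρ : ℕ → Algebra.Carrier A) where

    infix 4 _⊩_ _↝_

    -- A record, so that the world and the term can be inferred from a proof.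
    record _⊩_ (u : World) (t : Term) : Set where
      constructor holds
      field truth : proj₁ (⟦ A ⟧ t ρ) u ≡ true
    open _⊩_

    _↝_ : World → World → Set
    u ↝ v = w ⊢ u ↝ v

    ⊩∧-intro : ∀ {u s t} → u ⊩ s → u ⊩ t → u ⊩ s Terms.∧ t
    ⊩∧-intro p q = holds (≡.cong₂ Bool._∧_ (truth p) (truth q))

    ⊩∧-elim : ∀ {u s t} → u ⊩ s Terms.∧ t → u ⊩ s × u ⊩ t
    ⊩∧-elim (holds p) = let (q , r) = ∧-true p in holds q , holds r

    ⊩∨-introˡ : ∀ {u s t} → u ⊩ s → u ⊩ s Terms.∨ t
    ⊩∨-introˡ {u} {s} {t} p = holds (≡.cong (Bool._∨ proj₁ (⟦ A ⟧ t ρ) u) (truth p))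

    ⊩∨-introʳ : ∀ {u s t} → u ⊩ t → u ⊩ s Terms.∨ t
    ⊩∨-introʳ {u} {s} {t} p = holds
      (≡.trans (≡.cong (proj₁ (⟦ A ⟧ s ρ) u Bool.∨_) (truth p)) (Boolₚ.∨-zeroʳ _))

    ⊩∨-elim : ∀ {u s t} → u ⊩ s Terms.∨ t → u ⊩ s ⊎ u ⊩ t
    ⊩∨-elim (holds p) = Sum.map holds holds (∨-true p)

    ⊩′-intro : ∀ {u t} → ¬ u ⊩ t → u ⊩ t Terms.′
    ⊩′-intro ¬p = holds (true-not (¬p ∘ holds))

    ⊩′-elim : ∀ {u t} → u ⊩ t Terms.′ → ¬ u ⊩ t
    ⊩′-elim (holds p) q = not-true p (truth q)

    ⊩f-intro : ∀ {u v t} → v ⊩ t → ¬ u ↝ v → u ⊩ Terms.f t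
    ⊩f-intro {v = v} p ¬r = holds (◇-intro (Fᶠ w) (v , truth p , ¬r))

    ⊩f-elim : ∀ {u t} → u ⊩ Terms.f t → ∃ λ v → v ⊩ t × ¬ u ↝ v
    ⊩f-elim (holds p) = let (v , q , ¬r) = ◇-elim (Fᶠ w) p in v , holds q , ¬r

    ⊩g-intro : ∀ {u v t} → v ⊩ t → ¬ v ↝ u → u ⊩ Terms.g t
    ⊩g-intro {v = v} p ¬r = holds (◇-intro (Fᵍ w) (v , truth p , ¬r))

    ⊩g-elim : ∀ {u t} → u ⊩ Terms.g t → ∃ λ v → v ⊩ t × ¬ v ↝ u
    ⊩g-elim (holds p) = let (v , q , ¬r) = ◇-elim (Fᵍ w) p in v , holds q , ¬r

    ⊩pred-intro : ∀ {u t} → (∀ v → v ⊩ t → u ↝ v) → u ⊩ pred t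
    ⊩pred-intro p = ⊩′-intro λ q → let (v , v⊩t , ¬r) = ⊩f-elim q in ¬r (p v v⊩t)

    ⊩pred-elim : ∀ {u t} → u ⊩ pred t → ∀ {v} → v ⊩ t → u ↝ v
    ⊩pred-elim p v⊩t = decidable-stable em λ ¬r → ⊩′-elim p (⊩f-intro v⊩t ¬r)

    ⊩succ-intro : ∀ {u t} → (∀ v → v ⊩ t → v ↝ u) → u ⊩ succ t
    ⊩succ-intro p = ⊩′-intro λ q → let (v , v⊩t , ¬r) = ⊩g-elim q in ¬r (p v v⊩t)

    ⊩succ-elim : ∀ {u t} → u ⊩ succ t → ∀ {v} → v ⊩ t → v ↝ u
    ⊩succ-elim p v⊩t = decidable-stable em λ ¬r → ⊩′-elim p (⊩g-intro v⊩t ¬r)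

    ⊩below-intro : ∀ {u t} → (∀ v → ¬ v ⊩ t → u ↝ v) → u ⊩ below t
    ⊩below-intro p = ⊩pred-intro λ v q → p v (⊩′-elim q)

    ⊩below-elim : ∀ {u t} → u ⊩ below t → ∀ {v} → ¬ v ⊩ t → u ↝ v
    ⊩below-elim p ¬q = ⊩pred-elim p (⊩′-intro ¬q)

    -- A world of `below t` outside `t` would be related to itself.
    below⊆ : ∀ {u t} → u ⊩ below t → u ⊩ t
    below⊆ p = decidable-stable em λ ¬q → ↝-irrefl (⊩below-elim p ¬q)

    ⊩upto-intro : ∀ {u t} → ¬ (∀ v → v ⊩ below (below t) → v ↝ u) → u ⊩ upto t
    ⊩upto-intro p = ⊩′-intro λ q → p λ v → ⊩succ-elim q

    ⊩upto-elim : ∀ {u t} → u ⊩ upto t → ¬ (∀ v → v ⊩ below (below t) → v ↝ u)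
    ⊩upto-elim p q = ⊩′-elim p (⊩succ-intro q)

    Everywhere Nowhere Bounded : Term → Set
    Everywhere t = ∀ u → u ⊩ t
    Nowhere    t = ∀ u → ¬ u ⊩ t
    Bounded    t = ∃ λ M → (∃ λ a → (M , a) ⊩ t) × (∀ {l a} → (l , a) ⊩ t → l ≤ M)

    Cobounded : Term → Set
    Cobounded t = ∃ λ N → ∀ k a → N ≤ k → (k , a) ⊩ t

    somewhere-everywhere : ∀ {u t} → u ⊩ t → Everywhere (somewhere t)
    somewhere-everywhere {u} p v with em {P = w ⊢ v ↝ u}
    ... | no ¬v↝u = ⊩∨-introˡ (⊩f-intro p ¬v↝u)
    ... | yes v↝u = ⊩∨-introʳ (⊩g-intro p (↝-asym v↝u))

    somewhere-nowhere : ∀ {t} → Nowhere t → Nowhere (somewhere t)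
    somewhere-nowhere none u p with ⊩∨-elim p
    ... | inj₁ q = let (v , v⊩t , _) = ⊩f-elim q in none v v⊩t
    ... | inj₂ q = let (v , v⊩t , _) = ⊩g-elim q in none v v⊩t

    -- An empty arm therefore leaves no bits, which settles the empty and the cobounded case.
    bit⇒arm : ∀ n {u t} → u ⊩ bit n t → u ⊩ arm t
    bit⇒arm n p = proj₂ (⊩∧-elim (proj₁ (⊩∧-elim p)))

    arm-everywhere : ∀ {t} → Everywhere t → Nowhere (arm t)
    arm-everywhere all u p = ⊩′-elim (proj₂ (⊩∧-elim p))
      (⊩below-intro λ v ¬q → contradiction (⊩below-intro λ v′ ¬q′ → contradiction (all v′) ¬q′) ¬q)

    -- `below (below t)` is empty, so its `succ` is everything and `upto t` is empty.
    arm-nowhere : ∀ {t} → Nowhere t → Nowhere (arm t)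
    arm-nowhere none u p = ⊩upto-elim (proj₁ (⊩∧-elim p))
      λ v q → contradiction (below⊆ (below⊆ q)) (none v)

    module _ {t M} (t≤ : ∀ {l a} → (l , a) ⊩ t → l ≤ suc M ⊎ l ≡ 2 ℕ.+ M × ∃ λ b → a ≡ suc b)
             (t≥ : ∀ {l a} → l ≤ suc M → (l , a) ⊩ t)
             (t≥′ : ∀ {b} → (2 ℕ.+ M , suc b) ⊩ t) where

      below≤ : ∀ {l a} → (l , a) ⊩ below t → l ≤ suc M
      -- `next` and `code` lead to index 0 only. So this test world is reached by `far`, or by
      -- `step` from (M + 3 , 0), which lies outside `t`.
      below≤ {l} {a} p with ⊩below-elim p {3 ℕ.+ M , 1} outside
        where
        outside : ¬ (3 ℕ.+ M , 1) ⊩ t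
        outside q with t≤ q
        ... | inj₁ M+3≤M+1 = 2+n≰n M+3≤M+1
      ... | far (s≤s (s≤s l≤)) = l≤
      ... | step with t≤ (below⊆ p)
      ...   | inj₁ M+3≤M+1 = contradiction M+3≤M+1 2+n≰n

      below≥ : ∀ {l a} → l ≤ suc M → (l , a) ⊩ below t
      below≥ {l} {a} l≤ = ⊩below-intro go
        where
        go : ∀ v → ¬ v ⊩ t → (l , a) ↝ v
        go (m , b) ¬q with ℕₚ.m≤n⇒m<n∨m≡n (ℕₚ.≰⇒> (¬q ∘ t≥ {m} {b}))
        ... | inj₁ 2+M<m = far (ℕₚ.≤-trans (s≤s (s≤s l≤)) 2+M<m)
        go (m , suc b) ¬q | inj₂ ≡.refl = contradiction t≥′ ¬q
        go (m , zero)  ¬q | inj₂ ≡.refl with ℕₚ.m≤n⇒m<n∨m≡n l≤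
        ...   | inj₁ (s≤s l≤M) = far (s≤s (s≤s l≤M))
        ...   | inj₂ ≡.refl    = next

      below²≤ : ∀ {l a} → (l , a) ⊩ below (below t) → l ≤ M
      below²≤ {l} {a} p with ⊩below-elim p {2 ℕ.+ M , 1} (ℕₚ.1+n≰n ∘ below≤)
      ... | far (s≤s (s≤s l≤M)) = l≤M
      ... | step                = contradiction (below≤ (below⊆ p)) (ℕₚ.1+n≰n)

      below²≥ : ∀ {l a} → l ≤ M → (l , a) ⊩ below (below t)
      below²≥ l≤M = ⊩below-intro λ v ¬q →
        far (ℕₚ.≤-trans (s≤s (s≤s l≤M)) (ℕₚ.≰⇒> (¬q ∘ below≥)))

      upto-lower : ∀ {l a} → l ≤ M → (l , a) ⊩ upto t
      upto-lower l≤M = ⊩upto-intro λ p → ↝-irrefl (p _ (below²≥ l≤M))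

      upto-arm : ∀ {b} → (suc M , suc b) ⊩ upto t
      upto-arm {b} = ⊩upto-intro λ p → impossible (p (M , 0) (below²≥ ℕₚ.≤-refl))
        where
        impossible : ¬ (M , 0) ↝ (suc M , suc b)
        impossible (far (s≤s M<M)) = ℕₚ.1+n≰n M<M

      -- `next` reaches index 0 only, which separates the centre from the rest of level M + 1.
      upto-centre : ¬ (suc M , 0) ⊩ upto t
      upto-centre p = ⊩upto-elim p λ v q → go v (below²≤ q)
        where
        go : ∀ v → proj₁ v ≤ M → v ↝ (suc M , 0)
        go (l , a) l≤M with ℕₚ.m≤n⇒m<n∨m≡n l≤M
        ... | inj₁ l<M    = far (s≤s l<M)
        ... | inj₂ ≡.refl = next

      upto≤ : ∀ {l a} → (l , a) ⊩ upto t → l ≤ suc M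
      upto≤ p = ℕₚ.≮⇒≥ λ M+1<l → ⊩upto-elim p λ v q →
        far (ℕₚ.≤-trans (s≤s (s≤s (below²≤ q))) M+1<l)

      arm-intro : ∀ {b} → (suc M , suc b) ⊩ arm t
      arm-intro = ⊩∧-intro upto-arm (⊩′-intro λ q → ℕₚ.1+n≰n (below²≤ q))

      arm-elim : ∀ {u} → u ⊩ arm t → ∃ λ b → u ≡ (suc M , suc b)
      arm-elim {l , a} p with ℕₚ.≤-antisym (upto≤ (proj₁ (⊩∧-elim p)))
                                (ℕₚ.≰⇒> λ l≤M → ⊩′-elim (proj₂ (⊩∧-elim p)) (below²≥ l≤M))
      arm-elim {l , zero}  p | ≡.refl = contradiction (proj₁ (⊩∧-elim p)) upto-centre
      arm-elim {l , suc b} p | ≡.refl = b , ≡.refl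

      -- Both inclusions are proved together because `succ` reverses them. From (M + 1 , n) only
      -- `step` leads into the arm, since `code` returns to index 0.
      point-intro : ∀ n → (suc M , n) ⊩ point n t
      point-elim : ∀ n {u} → u ⊩ point n t → u ≡ (suc M , n)

      point-intro zero    = ⊩∧-intro (below≥ ℕₚ.≤-refl) (⊩′-intro upto-centre)
      point-intro (suc n) = ⊩∧-intro
        (⊩succ-intro λ v q → ≡.subst (_↝ _) (≡.sym (point-elim n q)) step) arm-intro

      point-elim zero {l , a} p with ℕₚ.≤-antisym (below≤ (proj₁ (⊩∧-elim p)))
                                       (ℕₚ.≰⇒> λ l≤M → ⊩′-elim (proj₂ (⊩∧-elim p)) (upto-lower l≤M))
      point-elim zero {l , zero}  p | ≡.refl = ≡.refl
      point-elim zero {l , suc b} p | ≡.refl = contradiction upto-arm (⊩′-elim (proj₂ (⊩∧-elim p)))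
      point-elim (suc n) p with arm-elim (proj₂ (⊩∧-elim p))
      ... | b , ≡.refl with ⊩succ-elim (proj₁ (⊩∧-elim p)) (point-intro n)
      ...   | far M+3≤M+1 = contradiction M+3≤M+1 2+n≰n
      ...   | step          = ≡.refl

      bit-intro : ∀ {n} → w n ≡ true → (suc M , 2 ℕ.+ n) ⊩ bit n t
      bit-intro {n} wn = ⊩∧-intro (point-intro (2 ℕ.+ n))
        (⊩pred-intro λ v q → ≡.subst (_ ↝_) (≡.sym (point-elim 0 q)) (code wn))

      bit-elim : ∀ {n u} → u ⊩ bit n t → w n ≡ true
      bit-elim {n} p with point-elim (2 ℕ.+ n) (proj₁ (⊩∧-elim p))
      -- Within a level only `code` leads to index 0.
      ... | ≡.refl with ⊩pred-elim (proj₂ (⊩∧-elim p)) (point-intro 0)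
      ...   | far M+3≤M+1 = contradiction M+3≤M+1 2+n≰n
      ...   | code wn       = wn

    module _ {t} (bounded : Bounded t) where
      private
        M = proj₁ bounded

      -- The first `g` adds each (M + 1 , b + 1), because `next` from level M reaches index 0 only.
      -- The second fills all levels up to M + 1 and does the same on level M + 2.
      top-lower : ∀ {m b} → m ≤ suc M → (m , b) ⊩ top t
      top≤ : ∀ {m b} → (m , b) ⊩ top t → m ≤ suc M ⊎ m ≡ 2 ℕ.+ M × ∃ λ c → b ≡ suc c
      top-arm : ∀ {b} → (2 ℕ.+ M , suc b) ⊩ top t

      private
        g-arm : ∀ {b} → (suc M , suc b) ⊩ Terms.g t
        g-arm {b} = ⊩g-intro (proj₂ (proj₁ (proj₂ bounded))) impossible
          where
          impossible : ∀ {a} → ¬ (M , a) ↝ (suc M , suc b)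
          impossible (far (s≤s M<M)) = ℕₚ.1+n≰n M<M

        g≤ : ∀ {m b} → (m , b) ⊩ Terms.g t → m ≤ suc M
        g≤ p with ⊩g-elim p
        ... | (l , a) , q , ¬r = ℕₚ.≮⇒≥ λ M+1<m →
          ¬r (far (ℕₚ.≤-trans (s≤s (s≤s (proj₂ (proj₂ bounded) q))) M+1<m))

      -- Within a level nothing leads from index `suc b` to `b`: `step` raises the index, and `code`
      -- lowers it by at least 2.
      top-lower {m} {b} m≤ = ⊩g-intro (g-arm {b}) λ p → impossible m≤ p
        where
        impossible : ∀ {m} → m ≤ suc M → ¬ (suc M , suc b) ↝ (m , b)
        impossible m≤ (far M+3≤m) = 2+n≰n (ℕₚ.≤-trans M+3≤m m≤)
        impossible m≤ next        = ℕₚ.1+n≰n m≤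

      top≤ {m} {b} p with ⊩g-elim p
      ... | (l , a) , q , ¬r with m ℕₚ.≤? suc M
      ...   | yes m≤ = inj₁ m≤
      ...   | no m≰ with ℕₚ.m≤n⇒m<n∨m≡n (ℕₚ.≰⇒> m≰)
      ...     | inj₁ M+2<m = contradiction (far (ℕₚ.≤-trans (s≤s (s≤s (g≤ q))) M+2<m)) ¬r
      top≤ {m} {suc c} p | (l , a) , q , ¬r | no m≰ | inj₂ ≡.refl = inj₂ (≡.refl , c , ≡.refl)
      top≤ {m} {zero}  p | (l , a) , q , ¬r | no m≰ | inj₂ ≡.refl with ℕₚ.m≤n⇒m<n∨m≡n (g≤ q)
      ... | inj₁ l<M+1  = contradiction (far (s≤s l<M+1)) ¬r
      ... | inj₂ ≡.refl = contradiction next ¬r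

      top-arm {b} = ⊩g-intro (g-arm {0}) impossible
        where
        impossible : ¬ (suc M , 1) ↝ (2 ℕ.+ M , suc b)
        impossible (far (s≤s (s≤s M<M))) = ℕₚ.1+n≰n M<M

      digit-everywhere : ∀ {n} → w n ≡ true → Everywhere (digit n t)
      digit-everywhere wn = somewhere-everywhere (bit-intro top≤ top-lower top-arm wn)

      digit-nowhere-bounded : ∀ {n} → w n ≡ false → Nowhere (digit n t)
      digit-nowhere-bounded wn = somewhere-nowhere λ u p →
        true≢false (≡.trans (≡.sym (bit-elim top≤ top-lower top-arm p)) wn)

    digit-nowhere-empty : ∀ {n t} → Nowhere t → Nowhere (digit n t)
    digit-nowhere-empty {n} {t} none = somewhere-nowhere λ u p → arm-nowhere
      (λ u₁ p₁ → let (u₂ , p₂ , _) = ⊩g-elim p₁ ; (u₃ , p₃ , _) = ⊩g-elim p₂ in none u₃ p₃)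
      u (bit⇒arm n p)

    digit-nowhere-cobounded : ∀ {n t} → Cobounded t → Nowhere (digit n t)
    digit-nowhere-cobounded {n} {t} (N , large) = somewhere-nowhere λ u p →
      arm-everywhere (λ v → ⊩g-intro (everywhere v) ↝-irrefl) u (bit⇒arm n p)
      where
      everywhere : Everywhere (Terms.g t)
      -- A world of `t` above level `k` does not lead down to it.
      everywhere (k , a) = ⊩g-intro (large (suc (N ℕ.⊔ k)) 0 (ℕₚ.m≤n⇒m≤1+n (ℕₚ.m≤m⊔n N k)))
        λ r → ℕₚ.1+n≰n (ℕₚ.≤-trans (s≤s (ℕₚ.m≤n⊔m N k)) (↝-level r))

    -- Lower `N` until the level just below it meets `t`.
    bounded-or-nowhere : ∀ t N → (∀ k a → N ≤ k → ¬ (k , a) ⊩ t) → Bounded t ⊎ Nowhere t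
    bounded-or-nowhere t zero    large = inj₂ λ (k , a) → large k a z≤n
    bounded-or-nowhere t (suc N) large with em {P = ∃ λ a → (N , a) ⊩ t}
    ... | yes a⊩t = inj₁ (N , a⊩t , λ {l} {a} p → ℕₚ.≮⇒≥ λ N<l → large l a N<l p)
    ... | no none = bounded-or-nowhere t N λ k a N≤k p → case k a p (ℕₚ.m≤n⇒m<n∨m≡n N≤k)
      where
      case : ∀ k a → (k , a) ⊩ t → ¬ (N < k ⊎ N ≡ k)
      case k a p (inj₁ N<k)    = large k a N<k p
      case k a p (inj₂ ≡.refl) = none (a , p)

    trichotomy : ∀ t → Bounded t ⊎ Nowhere t ⊎ Cobounded t
    trichotomy t with proj₂ (⟦ A ⟧ t ρ)
    ... | true , N , const = inj₂ (inj₂ (N , λ k a N≤k → holds (const k a N≤k)))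
    ... | false , N , const = Sum.map₂ inj₁ (bounded-or-nowhere t N λ k a N≤k p →
            true≢false (≡.trans (≡.sym (truth p)) (const k a N≤k)))

    digit-nowhere : ∀ {n} t → w n ≡ false → Nowhere (digit n t)
    digit-nowhere t wn with trichotomy t
    ... | inj₁ bounded          = digit-nowhere-bounded bounded wn
    ... | inj₂ (inj₁ none)      = digit-nowhere-empty none
    ... | inj₂ (inj₂ cobounded) = digit-nowhere-cobounded cobounded

    -- Neither set is empty and they cannot both be cobounded, so one has a highest level.
    digit-somewhere : ∀ {n} t → w n ≡ true → ∀ {u v} → u ⊩ t → v ⊩ t Terms.′ →
                      Everywhere (digit n t) ⊎ Everywhere (digit n (t Terms.′))
    digit-somewhere t wn {u} {v} u⊩t v⊩t′ with trichotomy t | trichotomy (t Terms.′)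
    ... | inj₁ bounded     | _                = inj₁ (digit-everywhere bounded wn)
    ... | inj₂ (inj₁ none) | _                = contradiction u⊩t (none u)
    ... | inj₂ (inj₂ _)    | inj₁ bounded     = inj₂ (digit-everywhere bounded wn)
    ... | inj₂ (inj₂ _)    | inj₂ (inj₁ none) = contradiction v⊩t′ (none v)
    ... | inj₂ (inj₂ (N , large)) | inj₂ (inj₂ (N′ , large′)) = contradiction
      (large (N ℕ.⊔ N′) 0 (ℕₚ.m≤m⊔n N N′)) (⊩′-elim (large′ (N ℕ.⊔ N′) 0 (ℕₚ.m≤n⊔m N N′)))

-- The covers

f-identity : Equation
f-identity = Terms.f (Terms.var 0) , Terms.var 0

f-reflexive g-reflexive : Equation
f-reflexive = Terms.var 0 Terms.∧ Terms.f (Terms.var 0) , Terms.var 0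
g-reflexive = Terms.var 0 Terms.∧ Terms.g (Terms.var 0) , Terms.var 0

-- If this is nonzero then `x` is neither 0 nor 1. If it vanishes and `x` is below `f x`, then
-- `f x ≈ x`.
boundary : Term
boundary = Terms.f (Terms.var 0) Terms.∧ Terms.var 0 Terms.′

-- digit n x is 0 when x contains the high levels, whence the disjunction with
-- digit n (x ′).
digit-off digit-off′ digit-on : ℕ → Equation
digit-off  n = digit n (Terms.var 0) , Terms.0#
digit-off′ n = digit n (Terms.var 0 Terms.′) , Terms.0#
digit-on   n =
  boundary Terms.∧ (digit n (Terms.var 0) Terms.∨ digit n (Terms.var 0 Terms.′)) , boundary

⊨f-identity⇒∈VarT₀ : ∀ A → IsTenseAlgebra A → A ⊨ f-identity → A ∈ class VarT₀
⊨f-identity⇒∈VarT₀ A tense A⊨ = Tense.∈VarT₀ tense λ x → A⊨ λ _ → x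

∈VarT₀⇒⊨f-identity : ∀ A → A ∈ class VarT₀ → A ⊨ f-identity
∈VarT₀⇒⊨f-identity A A∈ = A∈ f-identity λ { _ ≡.refl _ → ≡.refl }

-- Inclusion of varieties, with the algebra an explicit argument because it
-- cannot be inferred from a membership proof.
infix 4 _⊑_
_⊑_ : Variety → Variety → Set₁
V ⊑ W = ∀ A → A ∈ class V → A ∈ class W

TTA⊑TA : TTA ⊑ TA
TTA⊑TA A = Var-least TotalTenseAlgebras TA (λ (lift (tense , _)) → lift tense) {A}

open Lindenbaum f-identity

module Classical (em : ∀ {ℓ} → ExcludedMiddle ℓ) where
  open Complex em

  theory : (ℕ → Bool) → Theory
  theory w e = algebra w ⊨ e

  module _ (w : ℕ → Bool) where
    open Forcing em w
    open _⊩_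

    f-reflexive∈theory : f-reflexive ∈ theory w
    f-reflexive∈theory ρ u = true⇔true⇒≡ (proj₁ ∘ ∧-true) λ p →
      truth (⊩∧-intro ρ {s = Terms.var 0} (holds p)
        (⊩f-intro ρ {t = Terms.var 0} (holds p) ↝-irrefl))

    g-reflexive∈theory : g-reflexive ∈ theory w
    g-reflexive∈theory ρ u = true⇔true⇒≡ (proj₁ ∘ ∧-true) λ p →
      truth (⊩∧-intro ρ {s = Terms.var 0} (holds p)
        (⊩g-intro ρ {t = Terms.var 0} (holds p) ↝-irrefl))

    digit-off∈theory : ∀ {n} → w n ≡ false → digit-off n ∈ theory w
    digit-off∈theory wn ρ u = ≢true⇒≡false (digit-nowhere ρ (Terms.var 0) wn u ∘ holds)

    digit-off′∈theory : ∀ {n} → w n ≡ false → digit-off′ n ∈ theory w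
    digit-off′∈theory wn ρ u = ≢true⇒≡false (digit-nowhere ρ (Terms.var 0 Terms.′) wn u ∘ holds)

    digit-on∈theory : ∀ {n} → w n ≡ true → digit-on n ∈ theory w
    digit-on∈theory {n} wn ρ u = true⇔true⇒≡ (proj₁ ∘ ∧-true) λ p →
      let b = holds {t = boundary} p
          (u⊩fx , u⊩x′) = ⊩∧-elim ρ b
          (v , v⊩x , _) = ⊩f-elim ρ u⊩fx
      in truth (⊩∧-intro ρ b (digits (digit-somewhere ρ (Terms.var 0) wn v⊩x u⊩x′)))
      where
      digits : Everywhere ρ (digit n (Terms.var 0)) ⊎ Everywhere ρ (digit n (Terms.var 0 Terms.′)) →
               _⊩_ ρ u (digit n (Terms.var 0) Terms.∨ digit n (Terms.var 0 Terms.′))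
      digits (inj₁ all) = ⊩∨-introˡ ρ (all u)
      digits (inj₂ all) = ⊩∨-introʳ ρ (all u)

    f-identity∉theory : f-identity ∉ theory w
    f-identity∉theory ⊨ = true≢false (≡.trans (≡.sym fX) (⊨ (λ _ → X) (1 , 0)))
      where
      -- Level 0. As `↝` does not lead down, `f` adds (1 , 0) to it.
      X : Algebra.Carrier (algebra w)
      X = (λ (k , _) → k ℕ.≡ᵇ 0) , false , 1 , λ { (suc _) _ _ → ≡.refl }
      fX : ◇ (Fᶠ w) (proj₁ X) (1 , 0) ≡ true
      fX = ◇-intro (Fᶠ w) {proj₁ X} ((0 , 0) , ≡.refl , λ p → ℕₚ.1+n≰n (↝-level p))

  ⊨digits⇒⊨f-identity : ∀ A n → IsTenseAlgebra A → A ⊨ f-reflexive → A ⊨ digit-on n →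
                        A ⊨ digit-off n → A ⊨ digit-off′ n → A ⊨ f-identity
  ⊨digits⇒⊨f-identity A n tense reflexive on off off′ ρ = split (ρ 0)
    (trans (∧-comm _ _) (trans (reflexive ρ) (sym (∧-idem _))))
    (trans boundary≈0 (sym (∧-complementʳ _)))
    where
    open Tense tense
    boundary≈0 : f (ρ 0) ∧ ρ 0 ′ ≈ 0#
    boundary≈0 = begin
      f (ρ 0) ∧ ρ 0 ′                ≈⟨ on ρ ⟨
      (f (ρ 0) ∧ ρ 0 ′) ∧ (_ ∨ _)    ≈⟨ ∧-congˡ (∨-cong (off ρ) (off′ ρ)) ⟩
      (f (ρ 0) ∧ ρ 0 ′) ∧ (0# ∨ 0#)  ≈⟨ ∧-congˡ (∨-idem 0#) ⟩
      (f (ρ 0) ∧ ρ 0 ′) ∧ 0#         ≈⟨ ∧-zeroʳ _ ⟩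
      0#                             ∎

  -- Varieties of maximal theories

  cover : (ℕ → Bool) → Variety
  cover w = variety (completion (theory w))

  cover⊨theory : ∀ w A → A ∈ class (cover w) → ∀ e → e ∈ theory w → A ⊨ e
  cover⊨theory w A A∈ e e∈ = A∈ e (lift (0 , e∈))

  cover⊑TTA : ∀ w → cover w ⊑ TTA
  cover⊑TTA w A A∈ e e∈Id = cover⊨theory w A A∈ e (e∈Id (algebra w) (lift (isTense w , isTotal w)))

  cover-tense : ∀ w A → A ∈ class (cover w) → IsTenseAlgebra A
  cover-tense w A A∈ = lower (TTA⊑TA A (cover⊑TTA w A A∈))

  generic : (ℕ → Bool) → Algebra
  generic w = free (completion (theory w))

  generic∈cover : ∀ w → generic w ∈ class (cover w)
  generic∈cover w = free∈variety (completion (theory w))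

  generic⊭f-identity : ∀ w → ¬ generic w ⊨ f-identity
  -- The valuation `Terms.var` turns validity in the free algebra into derivability.
  generic⊭f-identity w ⊨ = completion-consistent
    (λ ⊢ → f-identity∉theory w (sound (algebra w) (λ _ → id) ⊢)) (⊨ Terms.var)

  -- Reflexivity makes `f` and `g` fix 1, so 0 and 1 form a copy of `T₀` inside the nontrivial
  -- generic algebra.
  VarT₀⊑cover : ∀ w → VarT₀ ⊑ cover w
  VarT₀⊑cover w A A∈ e e∈ = A∈ e λ { _ ≡.refl →
    T₀-satisfies
      (unit (theory⊨ f-reflexive (f-reflexive∈theory w) λ _ → 1#))
      (unit (theory⊨ g-reflexive (g-reflexive∈theory w) λ _ → 1#))
      (λ trivial → generic⊭f-identity w λ _ → trivial _ _) {e} (generic∈cover w e e∈) }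
    where
    open Tense (cover-tense w (generic w) (generic∈cover w))
    theory⊨ : ∀ e → e ∈ theory w → generic w ⊨ e
    theory⊨ = cover⊨theory w (generic w) (generic∈cover w)
    unit : ∀ {x} → 1# ∧ x ≈ 1# → x ≈ 1#
    unit = trans (sym (∧-identityˡ _))

  f-identical : Variety → Set₁
  f-identical X = ∀ A → A ∈ class X → A ⊨ f-identity

  cover-not-f-identical : ∀ w → ¬ f-identical (cover w)
  cover-not-f-identical w ⊨ = generic⊭f-identity w (⊨ (generic w) (generic∈cover w))

  -- An identity of `X` outside the completion would, together with it, yield `f x ≈ x` throughout
  -- `X`.
  cover-least : ∀ w X → X ⊑ cover w → ¬ f-identical X → cover w ⊑ X
  cover-least w X X⊑ X⊭ A A∈ = proj₂ axiomatised λ e e∈X → decidable-stable em λ A⊭e →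
    X⊭ λ B B∈ → sound B (λ
      { d (inj₁ d∈)     → X⊑ B B∈ d (lift d∈)
      ; d (inj₂ ≡.refl) → proj₁ axiomatised B∈ d e∈X })
      (completion-maximal em λ e∈ → A⊭e (A∈ e (lift e∈)))
    where open Variety X using (axiomatised)

  theory-cong : ∀ {w w′} → w ≗ w′ → ∀ e → e ∈ theory w → e ∈ theory w′
  theory-cong w≗w′ (s , t) ⊨ ρ u = ≡.trans (≡.sym (algebra-cong w≗w′ s ρ u))
    (≡.trans (⊨ ρ u) (algebra-cong w≗w′ t ρ u))

  cover-cong : ∀ {w w′} → w ≗ w′ → cover w ⊑ cover w′
  cover-cong {w} {w′} w≗w′ A A∈ e (lift e∈) = A∈ e (lift (completion-cong
    (λ {d} → theory-cong (≡.sym ∘ w≗w′) d) (λ {d} → theory-cong w≗w′ d) {e} e∈))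

  cover-separates : ∀ {w w′} n → w n ≡ true → w′ n ≡ false → ¬ cover w ⊑ cover w′
  cover-separates {w} {w′} n wn w′n w⊑w′ = generic⊭f-identity w
    (⊨digits⇒⊨f-identity (generic w) n (cover-tense w (generic w) ∈w)
      (cover⊨theory w (generic w) ∈w f-reflexive (f-reflexive∈theory w))
      (cover⊨theory w (generic w) ∈w (digit-on n) (digit-on∈theory w wn))
      (cover⊨theory w′ (generic w) ∈w′ (digit-off n) (digit-off∈theory w′ w′n))
      (cover⊨theory w′ (generic w) ∈w′ (digit-off′ n) (digit-off′∈theory w′ w′n)))
    where
    ∈w : generic w ∈ class (cover w)
    ∈w = generic∈cover w
    ∈w′ : generic w ∈ class (cover w′)
    ∈w′ = w⊑w′ (generic w) ∈w

  cover-injective : ∀ {w w′} → cover w ⊑ cover w′ → cover w′ ⊑ cover w → w ≗ w′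
  cover-injective {w} {w′} w⊑w′ w′⊑w n with w n in wn | w′ n in w′n
  ... | true  | true  = ≡.refl
  ... | false | false = ≡.refl
  ... | true  | false = contradiction w⊑w′ (cover-separates n wn w′n)
  ... | false | true  = contradiction w′⊑w (cover-separates n w′n wn)

  -- Varieties coded by their identities

  satisfies? : ∀ X n → Dec (∀ A → A ∈ class X → A ⊨ equation n)
  satisfies? X n = em

  -- The axioms of `Y` hold throughout `Y`, hence throughout `X`.
  same-identities : ∀ X Y → (∀ n → does (satisfies? X n) ≡ does (satisfies? Y n)) → X ⊑ Y
  same-identities X Y same A A∈ = proj₂ (Variety.axiomatised Y) λ e e∈ →
    ≡.subst (A ⊨_) (equation-index e) (transfer (index e) λ B B∈ →
      ≡.subst (B ⊨_) (≡.sym (equation-index e)) (proj₁ (Variety.axiomatised Y) B∈ e e∈))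
    where
    transfer : ∀ n → (∀ B → B ∈ class Y → B ⊨ equation n) → A ⊨ equation n
    transfer n Y⊨ with satisfies? X n | satisfies? Y n | same n
    ... | yes X⊨ | _      | _  = X⊨ A A∈
    ... | no _   | no Y⊭  | _  = contradiction Y⊨ Y⊭

  -- Covers among the subvarieties of any `V` between `TTA` and `TA`

  module _ (V : Variety) (VarT₀⊑V : VarT₀ ⊑ V) (TTA⊑V : TTA ⊑ V) (V⊑TA : V ⊑ TA) where

    bottom : Subvariety V
    bottom = VarT₀ , λ {A} → VarT₀⊑V A

    private
      Covers₀ = JoinIrreducibleCovers (Λ V) bottom

    coverIn : (ℕ → Bool) → Subvariety V
    coverIn w = cover w , λ {A} A∈ → TTA⊑V A (cover⊑TTA w A A∈)

    cover-covers : ∀ w → Covers (Λ V) (coverIn w) bottom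
    cover-covers w =
        ((λ {A} → VarT₀⊑cover w A)
        , λ (_ , w⊆T₀) → cover-not-f-identical w λ A A∈ → ∈VarT₀⇒⊨f-identity A (w⊆T₀ {A} A∈))
      , λ ((X , X⊆V) , (T₀⊆X , T₀≉X) , (X⊆w , X≉w)) →
          -- Being strictly above Var T₀, `X` violates `f x ≈ x` and so is the whole cover.
          X≉w (X⊆w , λ {A} → cover-least w X (λ B → X⊆w {B}) (λ X⊨ →
            T₀≉X (T₀⊆X , λ {B} B∈ → ⊨f-identity⇒∈VarT₀ B (lower (V⊑TA B (X⊆V B∈))) (X⊨ B B∈))) A)

    cover-joinIrreducible : ∀ w → JoinIrreducible (Λ V) (coverIn w)
    cover-joinIrreducible w =
        -- The trivial variety satisfies `f x ≈ x`.
        (λ (⊆⊥ , _) → cover-not-f-identical w λ A A∈ →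
          ⊆⊥ {A} A∈ f-identity λ B (lift trivial) _ → trivial _ _)
      , λ (X , X⊆V) (Y , Y⊆V) (⊆X∨Y , X∨Y⊆) →
          irreducible X Y (λ A → ⊆X∨Y {A}) (λ A → X∨Y⊆ {A})
      where
      -- If `X` and `Y` both satisfied `f x ≈ x`, so would their join. One of them violates it and
      -- is the whole cover.
      irreducible : ∀ X Y → cover w ⊑ X ⊔ᵛ Y → X ⊔ᵛ Y ⊑ cover w →
                    class (cover w) ≐ class X ⊎ class (cover w) ≐ class Y
      irreducible X Y ⊑X∨Y X∨Y⊑ with em {P = f-identical X}
      ... | no X⊭ = inj₁ ((λ {A} → cover-least w X X⊑ X⊭ A) , λ {A} → X⊑ A)
        where
        X⊑ : X ⊑ cover w
        X⊑ A = X∨Y⊑ A ∘ Var-upper (class X ∪ class Y) {A} ∘ inj₁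
      ... | yes X⊨ = inj₂ ((λ {A} → cover-least w Y Y⊑ Y⊭ A) , λ {A} → Y⊑ A)
        where
        Y⊑ : Y ⊑ cover w
        Y⊑ A = X∨Y⊑ A ∘ Var-upper (class X ∪ class Y) {A} ∘ inj₂
        Y⊭ : ¬ f-identical Y
        Y⊭ Y⊨ = cover-not-f-identical w λ A A∈ → ⊑X∨Y A A∈ f-identity
          λ { B (inj₁ B∈) → X⊨ B B∈ ; B (inj₂ B∈) → Y⊨ B B∈ }

    sequences↣covers : Injection (ℕ →-setoid Bool) Covers₀
    sequences↣covers = record
      { to        = λ w → coverIn w , cover-covers w , cover-joinIrreducible w
      ; cong      = λ w≗w′ → (λ {A} → cover-cong w≗w′ A) , λ {A} → cover-cong (≡.sym ∘ w≗w′) A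
      ; injective = λ (w⊆w′ , w′⊆w) → cover-injective (λ A → w⊆w′ {A}) (λ A → w′⊆w {A})
      }

    covers↣sequences : Injection Covers₀ (ℕ →-setoid Bool)
    covers↣sequences = record
      { to        = λ ((X , _) , _) n → does (satisfies? X n)
      ; cong      = λ {((X , _) , _)} {((Y , _) , _)} (X⊆Y , Y⊆X) n →
                      congruent (satisfies? X n) (satisfies? Y n)
                        (λ ⊨ A → ⊨ A ∘ Y⊆X) (λ ⊨ A → ⊨ A ∘ X⊆Y)
      ; injective = λ {((X , _) , _)} {((Y , _) , _)} same →
          (λ {A} → same-identities X Y same A) , λ {A} → same-identities Y X (≡.sym ∘ same) A
      }
      where
      congruent : ∀ {ℓ} {P Q : Set ℓ} (P? : Dec P) (Q? : Dec Q) → (P → Q) → (Q → P) →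
                  does P? ≡ does Q?
      congruent (yes _) (yes _) _ _ = ≡.refl
      congruent (no _)  (no _)  _ _ = ≡.refl
      congruent (yes p) (no ¬q) P⇒Q _ = contradiction (P⇒Q p) ¬q
      congruent (no ¬p) (yes q) _ Q⇒P = contradiction (Q⇒P q) ¬p

    cardinality : HasCardinality2^ℵ₀ Covers₀
    cardinality = CantorBernstein.bijection em sequences↣covers covers↣sequences

theorem3p22 : (∀ {ℓ} → ExcludedMiddle ℓ) →
    HasCardinality2^ℵ₀ (JoinIrreducibleCovers ΛTTA VarT₀∈ΛTTA)
    × HasCardinality2^ℵ₀ (JoinIrreducibleCovers ΛTA VarT₀∈ΛTA)
theorem3p22 em =
    cardinality TTA (λ A → proj₂ VarT₀∈ΛTTA {A}) (λ _ → id) TTA⊑TA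
  , cardinality TA  (λ A → proj₂ VarT₀∈ΛTA {A}) TTA⊑TA (λ _ → id)
  where open Classical em
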